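{- Let $t\ge1$, $r\ge1$, and write $t=2m+2$ if $t$ is even, $t=2m'+1$ if $t$ is odd; let $\xi=e^{2\pi i/t}$, $R=r+m$ and $R'=r+m'$. For the same $\beta$, $$\Phi_{t,r}=\Phi_{2,R}\Big|_{y=(\xi,\xi^2,\dots,\xi^m)}\ (t\text{ even}),\qquad \Phi_{t,r}=\Phi_{1,R'}\Big|_{y=(\xi,\xi^2,\dots,\xi^{m'})}\ (t\text{ odd}),$$ where $y$ denotes the first $m$ (respectively $m'$) free variables of the right-hand object and its remaining $r$ variables are left free. In both cases $N$ is unchanged: $2+2R=t+2r$ and $1+2R'=t+2r$.
   Context: For $t,r\ge1$ put $N=t+2r$, $\zeta=e^{2\pi i/t}$, $\delta=(N-1,N-2,\dots,0)$. For a strictly decreasing $\beta\in\mathbb Z^N$ with $\beta_N=0$, let $\lambda=\beta-\delta$ (a partition). Define $$\Phi_{t,r}(\beta)=\frac{\det(x_i^{\beta_j})_{i,j=1}^N}{\det(x_i^{\delta_j})_{i,j=1}^N}=s_\lambda(x),\qquad x=(1,\zeta,\dots,\zeta^{t-1},z_1,z_1^{ -1},\dots,z_r,z_r^{ -1}),$$ i.e. the Schur polynomial $s_\lambda$ in $N$ variables at all $t$-th roots of unity together with $r$ free reciprocal pairs. $\Phi_{2,R}$ has $R$ free variables and $\Phi_{1,R'}$ has $R'$ free variables; specialisation is of the Laurent polynomial $s_\lambda$. -}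

module Defs where

open import Level using (Level; _⊔_) renaming (suc to lsuc)
open import Algebra.Bundles using (RawRing; CommutativeRing)
open import Algebra.Apartness.Bundles using (HeytingField; HeytingCommutativeRing)
import Algebra.Definitions as AlgebraDefs
import Algebra.Definitions.RawSemiring as RawSemiringDefs
import Algebra.Properties.CommutativeSemiring.Exp as ExpProps
open import Data.Bool.Base using (if_then_else_)
open import Data.Fin.Base as Fin using (Fin; zero; suc; toℕ; opposite; punchIn; splitAt; remQuot)
open import Data.Integer.Base as ℤ using (ℤ; +_; -[1+_]; 0ℤ; 1ℤ; -1ℤ)
import Data.Integer.Properties as ℤₚ
open import Data.List.Base as List using (List; []; _∷_)
open import Data.Nat.Base as ℕ using (ℕ; zero; suc; NonZero)
open import Data.Product.Base using (_×_; _,_; proj₁; proj₂; ∃-syntax)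
open import Data.Sum.Base using (_⊎_; [_,_]′)
open import Data.Vec.Base as Vec using (Vec)
import Data.Vec.Properties as Vecₚ
open import Relation.Binary.PropositionalEquality.Core using (_≡_)
open import Relation.Nullary.Decidable using (does)

-- The algebraic properties of ℂ that make sense of roots of unity given as
-- exp (2πi / t): a field of characteristic 0 with a homomorphism exp from
-- the additive to the multiplicative group, whose kernel is exactly the
-- set of integer multiples of 2πi ≠ 0.  ℂ with its usual exponential is
-- the intended instance.
record ExponentialField (c ℓ₁ ℓ₂ : Level) : Set (lsuc (c ⊔ ℓ₁ ⊔ ℓ₂)) where
  field
    heytingField : HeytingField c ℓ₁ ℓ₂

  open HeytingField heytingField public

  commutativeRing : CommutativeRing c ℓ₁
  commutativeRing =
    HeytingCommutativeRing.commutativeRing heytingCommutativeRing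

  open CommutativeRing commutativeRing public
    using (rawRing; commutativeSemiring)
  open RawSemiringDefs (RawRing.rawSemiring rawRing) public
    using (_^_; product) renaming (_×_ to _·_)
  open AlgebraDefs _≈_ public using (Invertible)

  field
    characteristic-0 : ∀ n .{{_ : NonZero n}} → n · 1# # 0#
    exp              : Carrier → Carrier
    exp-cong         : ∀ {x y} → x ≈ y → exp x ≈ exp y
    exp-0            : exp 0# ≈ 1#
    exp-+            : ∀ x y → exp (x + y) ≈ exp x * exp y
    2πi              : Carrier
    2πi#0            : 2πi # 0#
    exp-2πi          : exp 2πi ≈ 1#
    exp-kernel       : ∀ {x} → exp x ≈ 1# →
                       ∃[ n ] (x ≈ n · 2πi ⊎ x ≈ - (n · 2πi))

  IsUnit : Carrier → Set _
  IsUnit = Invertible 1# _*_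

  ^-isUnit : ∀ {x} → IsUnit x → ∀ n → IsUnit (x ^ n)
  ^-isUnit {x} (y , yx , xy) n =
    y ^ n , pow yx , pow xy
    where
    open ExpProps commutativeSemiring using (^-distrib-*; ^-congˡ)
    1^ : ∀ n → 1# ^ n ≈ 1#
    1^ zero    = refl
    1^ (suc n) = trans (*-identityˡ _) (1^ n)
    pow : ∀ {u v} → u * v ≈ 1# → u ^ n * v ^ n ≈ 1#
    pow {u} {v} uv =
      trans (sym (^-distrib-* u v n)) (trans (^-congˡ n uv) (1^ n))

  unit^ : ∀ x → IsUnit x → ℤ → Carrier
  unit^ x _         (+ n)    = x ^ n
  unit^ x (x⁻¹ , _) -[1+ n ] = x⁻¹ ^ suc n

  2πi/_ : ∀ t .{{_ : NonZero t}} → Carrier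
  2πi/ t = proj₁ (#⇒invertible (characteristic-0 t)) * 2πi

  ζ : ∀ t .{{_ : NonZero t}} → Carrier
  ζ t = exp (2πi/ t)

  ζ-isUnit : ∀ t .{{_ : NonZero t}} → IsUnit (ζ t)
  ζ-isUnit t = exp (- w)
             , trans (sym (exp-+ (- w) w)) (trans (exp-cong (-‿inverseˡ w)) exp-0)
             , trans (sym (exp-+ w (- w))) (trans (exp-cong (-‿inverseʳ w)) exp-0)
    where w = 2πi/ t

module Determinant {a ℓ} (R : RawRing a ℓ) where
  open RawRing R
  open RawSemiringDefs rawSemiring using (_^_; sum)

  -- Laplace expansion along the first row.
  det : ∀ {n} → (Fin n → Fin n → Carrier) → Carrier
  det {zero}  M = 1#
  det {suc n} M = sum λ j →
    (- 1#) ^ toℕ j * M zero j * det λ i k → M (suc i) (punchIn j k)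

  alternant : ∀ {n} → (Fin n → Carrier) → (Fin n → ℕ) → Carrier
  alternant x β = det λ i j → x i ^ β j

-- Laurent polynomials over K in z₁, …, zᵣ: finite sums of terms (c , e),
-- standing for c z₁^e₁ ⋯ zᵣ^eᵣ, in which an exponent e may be repeated.
-- Equality is equality of all coefficients, so the order and grouping of
-- the terms is immaterial.
module LaurentPolynomials {c ℓ} (K : CommutativeRing c ℓ) where
  open CommutativeRing K

  Laurent : ℕ → Set c
  Laurent r = List (Carrier × Vec ℤ r)

  coeff : ∀ {r} → Laurent r → Vec ℤ r → Carrier
  coeff []            e = 0#
  coeff ((a , d) ∷ f) e =
    if does (Vecₚ.≡-dec ℤₚ._≟_ d e) then a + coeff f e else coeff f e

  infix 4 _≈ᴸ_
  _≈ᴸ_ : ∀ {r} → Laurent r → Laurent r → Set ℓ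
  f ≈ᴸ g = ∀ e → coeff f e ≈ coeff g e

  const : ∀ {r} → Carrier → Laurent r
  const a = List.[ a , Vec.replicate _ 0ℤ ]

  var var⁻¹ : ∀ {r} → Fin r → Laurent r
  var   i = List.[ 1# , Vec.replicate _ 0ℤ Vec.[ i ]≔ 1ℤ ]
  var⁻¹ i = List.[ 1# , Vec.replicate _ 0ℤ Vec.[ i ]≔ -1ℤ ]

  laurentRing : ℕ → RawRing c ℓ
  laurentRing r = record
    { Carrier = Laurent r
    ; _≈_     = _≈ᴸ_
    ; _+_     = List._++_
    ; _*_     = List.cartesianProductWith
                  λ (a , d) (b , e) → a * b , Vec.zipWith ℤ._+_ d e
    ; -_      = List.map λ (a , d) → - a , d
    ; 0#      = []
    ; 1#      = const 1#
    }

module Φ {c ℓ₁ ℓ₂} (ℂ : ExponentialField c ℓ₁ ℓ₂) where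
  open ExponentialField ℂ
  open LaurentPolynomials commutativeRing public

  size : ℕ → ℕ → ℕ
  size t r = t ℕ.+ r ℕ.* 2

  -- (1 , ζ , … , ζ^(t-1) , z₁ , z₁⁻¹ , … , zᵣ , zᵣ⁻¹)
  point : ∀ t r .{{_ : NonZero t}} → Fin (size t r) → Laurent r
  point t r i =
    [ (λ k → const (ζ t ^ toℕ k)) , (λ p → reciprocalPair (remQuot {r} 2 p)) ]′
      (splitAt t i)
    where
    reciprocalPair : Fin r × Fin 2 → Laurent r
    reciprocalPair (k , zero)     = var k
    reciprocalPair (k , suc zero) = var⁻¹ k

  -- (n-1 , n-2 , … , 0)
  δ : ∀ {n} → Fin n → ℕ
  δ j = toℕ (opposite j)

  -- IsΦ t r β f says that f is the quotient of alternants
  -- det (xᵢ^βⱼ) / det (xᵢ^δⱼ), x = point t r, in the ring of Laurent polynomials.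
  -- The denominator is a nonzero element of that integral domain, so there
  -- is at most one such f; when β is strictly decreasing it exists and is
  -- the Schur polynomial of the partition β - δ, evaluated at x.
  IsΦ : ∀ t r .{{_ : NonZero t}} → (Fin (size t r) → ℕ) → Laurent r → Set ℓ₁
  IsΦ t r β f = f *ᴸ alternant (point t r) δ ≈ᴸ alternant (point t r) β
    where
    open RawRing (laurentRing r) using () renaming (_*_ to infixl 7 _*ᴸ_)
    open Determinant (laurentRing r)

  -- Substitutes units for the first m variables, keeping the other r free.
  specialise : ∀ {m r} (y : Fin m → Carrier) → (∀ k → IsUnit (y k)) →
               Laurent (m ℕ.+ r) → Laurent r
  specialise {m} y y-unit = List.map λ (a , e) →
    a * product (λ k → unit^ (y k) (y-unit k) (Vec.lookup (Vec.take m e) k)) ,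
    Vec.drop m e

  -- y = (ξ , ξ² , … , ξᵐ) with ξ = e^(2πi/t)
  specialiseAtRoots : ∀ t .{{_ : NonZero t}} m {r} → Laurent (m ℕ.+ r) → Laurent r
  specialiseAtRoots t m = specialise {m}
    (λ k → ζ t ^ suc (toℕ k)) (λ k → ^-isUnit (ζ-isUnit t) (suc (toℕ k)))

-- A strictly decreasing integer sequence ending in 0 has no negative
-- entries, so taking the entries in ℕ loses nothing.
StrictlyDecreasing : ∀ {n} → (Fin n → ℕ) → Set
StrictlyDecreasing β = ∀ {i j} → i Fin.< j → β j ℕ.< β i

EndsInZero : ∀ {n} → (Fin n → ℕ) → Set
EndsInZero {n} β = ∀ i → suc (toℕ i) ≡ n → β i ≡ 0

{-# OPTIONS --safe #-}

-- Substituting ξ, …, ξᵐ for the first m free variables is a ring homomorphism σ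
-- from Laurent polynomials in m + r variables to those in r variables.  As ξ⁻ᵏ = ξᵗ⁻ᵏ,
-- it turns the points 1 (and -1 = ξᵐ⁺¹ for even t), y₁, y₁⁻¹, …, z₁, z₁⁻¹, … into a
-- permutation of the points 1, ξ, …, ξᵗ⁻¹, z₁, z₁⁻¹, ….  Permuting the points multiplies
-- every alternant by one and the same sign, which cancels from the quotient; hence f and
-- σ g have the same product with the Vandermonde determinant of the latter points.  That
-- determinant is not a zero divisor because no difference of two of the points is: these
-- differences are a zᵈ - b zᵉ with d ≠ e and a, b invertible, or (ξⁱ - ξʲ) with ξⁱ ≠ ξʲ.

module Submission where

open import Defs
open import Algebra.Bundles using (CommutativeRing; RawRing)
open import Algebra.Morphism.Structures using (module RingMorphisms)
open import Algebra.Structures using (IsCommutativeRing)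
open import Data.Bool.Base using (true; false; if_then_else_)
open import Data.Fin.Base using (Fin; zero; suc; toℕ; fromℕ; inject₁; cast; opposite;
  punchIn; pinch; _↑ˡ_; _↑ʳ_; splitAt; remQuot; quotRem; combine)
import Data.Fin.Properties as Fin
open import Data.Integer.Base as ℤ using (ℤ; +_; -[1+_]; 0ℤ; 1ℤ; -1ℤ)
import Data.Integer.Properties as ℤ
open import Data.Integer.Solver using () renaming (module +-*-Solver to ℤSolver)
open import Data.List.Base as List using (List; []; _∷_; _++_; _∷ʳ_; tabulate; length; lookup)
import Data.List.Properties as List
import Data.List.Relation.Binary.Permutation.Setoid as Permutation
import Data.List.Relation.Binary.Permutation.Setoid.Properties as PermutationProperties
open import Data.List.Relation.Binary.Pointwise as Pointwise using (Pointwise; []; _∷_)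
open import Data.Nat.Base as ℕ using (ℕ; zero; suc; NonZero)
open import Data.Nat.Divisibility as ℕ using (_∣_; divides)
open import Data.Nat.GeneralisedArithmetic using (iterate)
import Data.Nat.Properties as ℕ
open import Data.Nat.Solver using () renaming (module +-*-Solver to ℕSolver)
open import Data.Product.Base using (_×_; _,_; proj₁; proj₂; ∃-syntax; Σ-syntax)
open import Data.Sum.Base as Sum using (_⊎_; inj₁; inj₂)
open import Data.Vec.Base as Vec using (Vec; _[_]≔_)
import Data.Vec.Properties as Vec
open import Function.Base using (_∘_; _$_)
open import Level using (_⊔_)
open import Relation.Binary.Bundles using (Setoid)
open import Relation.Binary.Core using (Rel)
open import Relation.Binary.Definitions using (tri<; tri≈; tri>)
open import Relation.Binary.PropositionalEquality as ≡ using (_≡_; _≢_; module ≡-Reasoning)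
open import Relation.Binary.Structures using (IsEquivalence)
open import Relation.Nullary using (yes; no; does; ¬_)
open import Relation.Nullary.Negation using (contradiction)

-- `IsΦ` gives `f` and `g` only through their products with an alternant, and equality in the field
-- is not assumed decidable. So the denominator has to be cancelled without dividing by it and
-- without searching for a leading term. Its regularity comes from interpolation instead of the
-- product formula: if `h` times a polynomial of degree n vanishes at n + 1 points with regular
-- differences, then `h` kills the leading coefficient. Only differences of two points remain to be
-- examined, and these have at most two terms. A Laurent polynomial is a list in which exponents may
-- repeat, so identities are not checked on the lists themselves. They are checked against every
-- function `φ` on exponents, where products and substitutions become iterated finite sums. Both
-- parities are one argument with t = 1 + m + w + m: the w middle exponents are those without a
-- partner, w = 1 for even and w = 0 for odd t.

-- Column indices after two deletions.

punchIn-pinch : ∀ {n} (j : Fin (suc n)) (k : Fin n) → punchIn (punchIn j k) (pinch k j) ≡ j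
punchIn-pinch zero    zero    = ≡.refl
punchIn-pinch zero    (suc k) = ≡.refl
punchIn-pinch (suc j) zero    = ≡.refl
punchIn-pinch (suc j) (suc k) = ≡.cong suc (punchIn-pinch j k)

-- `pinch k j` is the position of column `j` once column `punchIn j k` is deleted. Both sides
-- therefore enumerate, in increasing order, the columns other than `j` and `punchIn j k`.
punchIn-punchIn : ∀ {n} (j : Fin (suc (suc n))) (k : Fin (suc n)) (l : Fin n) →
                  punchIn (punchIn j k) (punchIn (pinch k j) l) ≡ punchIn j (punchIn k l)
punchIn-punchIn zero    zero    l       = ≡.refl
punchIn-punchIn zero    (suc k) l       = ≡.refl
punchIn-punchIn (suc j) zero    l       = ≡.refl
punchIn-punchIn (suc j) (suc k) zero    = ≡.refl
punchIn-punchIn (suc j) (suc k) (suc l) = ≡.cong suc (punchIn-punchIn j k l)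


-- Laplace determinants with exchanged or equal rows.

module DeterminantProperties {c ℓ} (R : CommutativeRing c ℓ) where
  open CommutativeRing R hiding (zero)
  private module ≈ = CommutativeRing R
  open Determinant rawRing
  open import Algebra.Properties.Semiring.Sum semiring
  open import Algebra.Properties.Semiring.Exp semiring using (_^_; ^-congˡ; ^-cong)
  open import Algebra.Properties.Ring ring
    using (-‿distribˡ-*; -‿distribʳ-*; -1*x≈-x; -‿involutive; -‿+-comm; -0#≈0#; +-inverseʳ-unique)
  open import Algebra.Solver.Ring.NaturalCoefficients.Default commutativeSemiring
    using (solve; _:+_; _:*_; _:=_)
  open import Relation.Binary.Reasoning.Setoid setoid

  Matrix : ℕ → Set c
  Matrix n = Fin n → Fin n → Carrier

  sum-cong : ∀ {n} (f g : Fin n → Carrier) → (∀ i → f i ≈ g i) → sum f ≈ sum g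
  sum-cong f g = sum-cong-≋

  sign : ℕ → Carrier
  sign = (- 1#) ^_

  minor : ∀ {n} → Matrix (suc n) → Fin (suc n) → Matrix n
  minor M j i k = M (suc i) (punchIn j k)

  cofactorTerm : ∀ {n} → Matrix (suc n) → Fin (suc n) → Carrier
  cofactorTerm M j = sign (toℕ j) * M zero j * det (minor M j)

  det-cong : ∀ {n} (M N : Matrix n) → (∀ i j → M i j ≈ N i j) → det M ≈ det N
  det-cong {zero}  M N M≈N = refl
  det-cong {suc n} M N M≈N = sum-cong (cofactorTerm M) (cofactorTerm N) λ j →
    *-cong (*-congˡ {sign (toℕ j)} (M≈N zero j))
           (det-cong (minor M j) (minor N j) λ i k → M≈N (suc i) (punchIn j k))

  sum≈0 : ∀ {n} (f : Fin n → Carrier) → (∀ i → f i ≈ 0#) → sum f ≈ 0#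
  sum≈0 {n} f f≈0 = trans (sum-cong-≋ f≈0) (sum-replicate-zero n)

  -- (j , k) ↦ (punchIn j k , pinch k j) exchanges the columns j and punchIn j k.
  sum-antisymmetric : ∀ {n} (H : Fin (suc n) → Fin n → Carrier) →
                      (∀ j k → H j k + H (punchIn j k) (pinch k j) ≈ 0#) →
                      sum (λ j → sum (H j)) ≈ 0#
  sum-antisymmetric {zero}  H anti = +-identityˡ 0#
  sum-antisymmetric {suc n} H anti = begin
    sum (H zero) + sum (λ j → H (suc j) zero + sum (H (suc j) ∘ suc))
      ≈⟨ +-congˡ (∑-distrib-+ (λ j → H (suc j) zero) (λ j → sum (H (suc j) ∘ suc))) ⟩
    sum (H zero) + (sum (λ j → H (suc j) zero) + sum (λ j → sum (H (suc j) ∘ suc)))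
      ≈⟨ +-assoc _ _ _ ⟨
    sum (H zero) + sum (λ j → H (suc j) zero) + sum (λ j → sum (H (suc j) ∘ suc))
      -- The pairs that involve column `zero` are `(zero , k)` and `(suc k , zero)`, which are
      -- partners; all other pairs form the same pattern one size smaller.
      ≈⟨ +-cong (sym (∑-distrib-+ (H zero) (λ j → H (suc j) zero)))
                 (sum-antisymmetric (λ j k → H (suc j) (suc k)) λ j k → anti (suc j) (suc k)) ⟩
    sum (λ k → H zero k + H (suc k) zero) + 0#
      ≈⟨ +-identityʳ _ ⟩
    sum (λ k → H zero k + H (suc k) zero)
      ≈⟨ sum≈0 (λ k → H zero k + H (suc k) zero) (anti zero) ⟩
    0# ∎

  sign-suc : ∀ n → sign (suc n) ≈ - sign n
  sign-suc n = -1*x≈-x (sign n)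

  -- For `k < j` the new positions are `k` and `j - 1`, otherwise `k + 1` and `j`. Either way their
  -- sum changes by exactly one.
  sign-exchange : ∀ {n} (j : Fin (suc n)) (k : Fin n) →
                  sign (toℕ (punchIn j k)) * sign (toℕ (pinch k j)) ≈
                  - (sign (toℕ j) * sign (toℕ k))
  sign-exchange zero zero = begin
    sign 1 * 1#     ≈⟨ *-congʳ (sign-suc 0) ⟩
    - 1# * 1#       ≈⟨ -‿distribˡ-* _ _ ⟨
    - (1# * 1#)     ∎
  sign-exchange zero (suc k) = begin
    sign (suc (suc (toℕ k))) * 1# ≈⟨ *-congʳ (sign-suc (suc (toℕ k))) ⟩
    - sign (suc (toℕ k)) * 1#     ≈⟨ *-identityʳ _ ⟩
    - sign (suc (toℕ k))          ≈⟨ -‿cong (*-identityˡ _) ⟨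
    - (1# * sign (suc (toℕ k)))   ∎
  sign-exchange (suc j) zero = begin
    1# * sign (toℕ j)             ≈⟨ *-identityˡ _ ⟩
    sign (toℕ j)                  ≈⟨ -‿involutive _ ⟨
    - - sign (toℕ j)              ≈⟨ -‿cong (sign-suc (toℕ j)) ⟨
    - sign (suc (toℕ j))          ≈⟨ -‿cong (*-identityʳ _) ⟨
    - (sign (suc (toℕ j)) * 1#)   ∎
  sign-exchange (suc j) (suc k) = begin
    (- 1# * a) * (- 1# * b)     ≈⟨ exch (- 1#) a b ⟩
    - 1# * - 1# * (a * b)       ≈⟨ *-congˡ (sign-exchange j k) ⟩
    - 1# * - 1# * - (c′ * d)    ≈⟨ -‿distribʳ-* _ _ ⟨
    - (- 1# * - 1# * (c′ * d))  ≈⟨ -‿cong (exch (- 1#) c′ d) ⟨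
    - ((- 1# * c′) * (- 1# * d)) ∎
    where
    a = sign (toℕ (punchIn j k))
    b = sign (toℕ (pinch k j))
    c′ = sign (toℕ j)
    d = sign (toℕ k)
    exch : ∀ e x y → (e * x) * (e * y) ≈ e * e * (x * y)
    exch = solve 3 (λ e x y → (e :* x) :* (e :* y) := e :* e :* (x :* y)) refl

  -- A term of the expansion along two rows at once: `u` uses column `j` and `v` uses column
  -- `punchIn j k`. The two rows are arguments of their own, so that exchanging them is exchanging
  -- `u` and `v`.
  twoRowTerm : ∀ {n} → (u v : Fin (suc (suc n)) → Carrier) → (Fin n → Fin (suc (suc n)) → Carrier) →
          Fin (suc (suc n)) → Fin (suc n) → Carrier
  twoRowTerm u v M j k =
    sign (toℕ j) * u j *
    (sign (toℕ k) * v (punchIn j k) * det λ i l → M i (punchIn j (punchIn k l)))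

  det-expand₂ : ∀ {n} (M : Matrix (suc (suc n))) →
                det M ≈ sum λ j → sum (twoRowTerm (M zero) (M (suc zero)) (λ i → M (suc (suc i))) j)
  det-expand₂ M = sum-cong (cofactorTerm M)
    (λ j → sum (twoRowTerm (M zero) (M (suc zero)) (λ i → M (suc (suc i))) j))
    λ j → *-distribˡ-sum (sign (toℕ j) * M zero j) (cofactorTerm (minor M j))

  twoRowTerm-exchange : ∀ {n} u v (M : Fin n → Fin (suc (suc n)) → Carrier) j k →
                   twoRowTerm v u M (punchIn j k) (pinch k j) ≈ - twoRowTerm u v M j k
  twoRowTerm-exchange u v M j k = begin
    sign (toℕ (punchIn j k)) * v (punchIn j k) *
      (sign (toℕ (pinch k j)) * u (punchIn (punchIn j k) (pinch k j)) *
        det λ i l → M i (punchIn (punchIn j k) (punchIn (pinch k j) l)))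
      ≈⟨ *-congˡ (*-cong (*-congˡ (reflexive (≡.cong u (punchIn-pinch j k))))
           (det-cong _ (λ i l → M i (punchIn j (punchIn k l))) λ i l → reflexive (≡.cong (M i) (punchIn-punchIn j k l)))) ⟩
    sign (toℕ (punchIn j k)) * v (punchIn j k) * (sign (toℕ (pinch k j)) * u j * D)
      ≈⟨ solve 5 (λ s x s′ y d → s :* x :* (s′ :* y :* d) := s :* s′ :* (y :* x :* d)) refl _ _ _ _ _ ⟩
    sign (toℕ (punchIn j k)) * sign (toℕ (pinch k j)) * (u j * v (punchIn j k) * D)
      ≈⟨ *-congʳ (sign-exchange j k) ⟩
    - (sign (toℕ j) * sign (toℕ k)) * (u j * v (punchIn j k) * D)
      ≈⟨ -‿distribˡ-* _ _ ⟨
    - (sign (toℕ j) * sign (toℕ k) * (u j * v (punchIn j k) * D))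
      ≈⟨ -‿cong (solve 5 (λ s x s′ y d → s :* x :* (s′ :* y :* d) := s :* s′ :* (x :* y :* d)) refl _ _ _ _ _) ⟨
    - twoRowTerm u v M j k ∎
    where
    D = det λ i l → M i (punchIn j (punchIn k l))

  swap₀₁ : ∀ {n} → Fin (suc (suc n)) → Fin (suc (suc n))
  swap₀₁ zero          = suc zero
  swap₀₁ (suc zero)    = zero
  swap₀₁ (suc (suc i)) = suc (suc i)

  -- `twoRowTerm u v` alone need not be antisymmetric: exchanging the columns gives minus
  -- `twoRowTerm v u`. The sum of the two is antisymmetric, hence the two determinants add up to
  -- zero.
  det-swap : ∀ {n} (M : Matrix (suc (suc n))) → det (M ∘ swap₀₁) ≈ - det M
  det-swap M = +-inverseʳ-unique _ _ total
    where
    u = M zero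
    v = M (suc zero)
    L = λ i → M (suc (suc i))
    total : det M + det (M ∘ swap₀₁) ≈ 0#
    total = begin
      det M + det (M ∘ swap₀₁)
        ≈⟨ +-cong (det-expand₂ M) (det-expand₂ (M ∘ swap₀₁)) ⟩
      sum (λ j → sum (twoRowTerm u v L j)) + sum (λ j → sum (twoRowTerm v u L j))
        ≈⟨ ∑-distrib-+ (λ j → sum (twoRowTerm u v L j)) (λ j → sum (twoRowTerm v u L j)) ⟨
      sum (λ j → sum (twoRowTerm u v L j) + sum (twoRowTerm v u L j))
        ≈⟨ sum-cong (λ j → sum (λ k → twoRowTerm u v L j k + twoRowTerm v u L j k))
                    (λ j → sum (twoRowTerm u v L j) + sum (twoRowTerm v u L j))
           (λ j → ∑-distrib-+ (twoRowTerm u v L j) (twoRowTerm v u L j)) ⟨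
      sum (λ j → sum (λ k → twoRowTerm u v L j k + twoRowTerm v u L j k))
        ≈⟨ sum-antisymmetric (λ j k → twoRowTerm u v L j k + twoRowTerm v u L j k) (λ j k → begin
             twoRowTerm u v L j k + twoRowTerm v u L j k +
               (twoRowTerm u v L (punchIn j k) (pinch k j) + twoRowTerm v u L (punchIn j k) (pinch k j))
               ≈⟨ +-congˡ (trans (+-comm _ _) (+-cong (twoRowTerm-exchange u v L j k) (twoRowTerm-exchange v u L j k))) ⟩
             twoRowTerm u v L j k + twoRowTerm v u L j k + (- twoRowTerm u v L j k + - twoRowTerm v u L j k)
               ≈⟨ +-congˡ (-‿+-comm _ _) ⟩
             _ + - (twoRowTerm u v L j k + twoRowTerm v u L j k)
               ≈⟨ -‿inverseʳ _ ⟩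
             0# ∎) ⟩
      0# ∎

  -- `det-swap` would only show that twice the determinant vanishes, which is too weak where 2 is a
  -- zero divisor. If rows 0 and 1 agree, `twoRowTerm` itself is antisymmetric. If the equal row is
  -- lower, swapping rows 0 and 1 makes the original first row the top row of every minor, with its
  -- equal still below it.
  det-equal-rows : ∀ {n} (M : Matrix (suc n)) k → (∀ j → M zero j ≈ M (suc k) j) → det M ≈ 0#
  det-equal-rows {suc n} M zero eq = trans (det-expand₂ M) $
    sum-antisymmetric (twoRowTerm (M zero) (M (suc zero)) λ i → M (suc (suc i))) λ j k → begin
    twoRowTerm u v L j k + twoRowTerm u v L (punchIn j k) (pinch k j)
      ≈⟨ +-congˡ (*-cong (*-congˡ (eq _)) (*-congʳ (*-congˡ (sym (eq _))))) ⟩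
    twoRowTerm u v L j k + twoRowTerm v u L (punchIn j k) (pinch k j)
      ≈⟨ +-congˡ (twoRowTerm-exchange u v L j k) ⟩
    twoRowTerm u v L j k + - twoRowTerm u v L j k
      ≈⟨ -‿inverseʳ _ ⟩
    0# ∎
    where
    u = M zero
    v = M (suc zero)
    L = λ i → M (suc (suc i))
  det-equal-rows {suc n} M (suc k) eq = begin
    det M                 ≈⟨ -‿involutive _ ⟨
    - - det M             ≈⟨ -‿cong (det-swap M) ⟨
    - det (M ∘ swap₀₁)    ≈⟨ -‿cong (sum≈0 (cofactorTerm (M ∘ swap₀₁)) λ j → trans
                               (*-congˡ (det-equal-rows (minor (M ∘ swap₀₁) j) k λ l → eq (punchIn j l)))
                               (zeroʳ _)) ⟩
    - 0#                  ≈⟨ -0#≈0# ⟩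
    0#                    ∎

  -- Alternants under a permutation of their points.

  alternant-congˡ : ∀ {n} {x y : Fin n → Carrier} (β : Fin n → ℕ) → (∀ i → x i ≈ y i) →
                    alternant x β ≈ alternant y β
  alternant-congˡ {x = x} {y} β x≈y =
    det-cong (λ i j → x i ^ β j) (λ i j → y i ^ β j) λ i j → ^-congˡ (β j) (x≈y i)

  alternant-congʳ : ∀ {n} (x : Fin n → Carrier) {β γ : Fin n → ℕ} → (∀ j → β j ≡ γ j) →
                    alternant x β ≈ alternant x γ
  alternant-congʳ x {β} {γ} β≡γ =
    det-cong (λ i j → x i ^ β j) (λ i j → x i ^ γ j) λ i j → ^-cong {x = x i} ≈.refl (β≡γ j)

  open Permutation setoid using (_↭_; refl; prep; swap; trans)
  open PermutationProperties setoid using (xs↭ys⇒|xs|≡|ys|)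

  entry : ∀ {n} (xs : List Carrier) .(n≡ : n ≡ length xs) → Fin n → Carrier
  entry xs n≡ i = lookup xs (cast n≡ i)

  entry-cong : ∀ {n xs ys} → Pointwise _≈_ xs ys →
               .(p : n ≡ length xs) .(q : n ≡ length ys) → ∀ i → entry xs p i ≈ entry ys q i
  entry-cong (x≈y ∷ eqs) p q zero    = x≈y
  entry-cong (x≈y ∷ eqs) p q (suc i) = entry-cong eqs _ _ i

  -- The factor `s` is fixed before `β`. Induction on the list needs this: expanding along the first
  -- row produces alternants of the tail with the exponents `β ∘ punchIn j`, one for each column,
  -- and all must share the factor.
  Proportional : Carrier → List Carrier → List Carrier → Set ℓ
  Proportional s xs ys = ∀ {n} .(p : n ≡ length xs) .(q : n ≡ length ys) (β : Fin n → ℕ) →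
    alternant (entry xs p) β ≈ s * alternant (entry ys q) β

  proportional-∷ : ∀ {s x y xs ys} → x ≈ y → Proportional s xs ys →
                   Proportional s (x ∷ xs) (y ∷ ys)
  proportional-∷ {s} {x} {y} {xs} {ys} x≈y s∣ {suc n} p q β = begin
    sum (cofactorTerm A)
      ≈⟨ sum-cong (cofactorTerm A) (λ j → s * cofactorTerm B j) (λ j → begin
           sign (toℕ j) * x ^ β j * alternant (entry xs _) (β ∘ punchIn j)
             ≈⟨ *-cong (*-congˡ (^-congˡ (β j) x≈y))
                       (s∣ (≡.cong ℕ.pred p) (≡.cong ℕ.pred q) (β ∘ punchIn j)) ⟩
           sign (toℕ j) * y ^ β j * (s * alternant (entry ys _) (β ∘ punchIn j))
             ≈⟨ solve 3 (λ a s d → a :* (s :* d) := s :* (a :* d)) ≈.refl _ _ _ ⟩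
           s * cofactorTerm B j ∎) ⟩
    sum (λ j → s * cofactorTerm B j)
      ≈⟨ *-distribˡ-sum s (cofactorTerm B) ⟨
    s * sum (cofactorTerm B) ∎
    where
    A B : Matrix (suc n)
    A i j = entry (x ∷ xs) p i ^ β j
    B i j = entry (y ∷ ys) q i ^ β j

  proportional-swap : ∀ x y xs → Proportional (- 1#) (x ∷ y ∷ xs) (y ∷ x ∷ xs)
  proportional-swap x y xs {suc (suc n)} p q β = begin
    det A              ≈⟨ det-cong A (B ∘ swap₀₁) A≈B∘swap ⟩
    det (B ∘ swap₀₁)   ≈⟨ det-swap B ⟩
    - det B            ≈⟨ -1*x≈-x _ ⟨
    - 1# * det B       ∎
    where
    A B : Matrix (suc (suc n))
    A i j = entry (x ∷ y ∷ xs) p i ^ β j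
    B i j = entry (y ∷ x ∷ xs) q i ^ β j
    A≈B∘swap : ∀ i j → A i j ≈ B (swap₀₁ i) j
    A≈B∘swap zero          j = ≈.refl
    A≈B∘swap (suc zero)    j = ≈.refl
    A≈B∘swap (suc (suc i)) j = ≈.refl

  proportional-trans : ∀ {s s′ xs ys zs} → length xs ≡ length ys → Proportional s xs ys →
                       Proportional s′ ys zs → Proportional (s * s′) xs zs
  proportional-trans {s} {s′} eq s∣ s′∣ p q β =
    ≈.trans (s∣ p (≡.trans p eq) β)
            (≈.trans (*-congˡ (s′∣ (≡.trans p eq) q β)) (sym (*-assoc s s′ _)))

  *-involutory : ∀ {s s′} → s * s ≈ 1# → s′ * s′ ≈ 1# → (s * s′) * (s * s′) ≈ 1#
  *-involutory {s} {s′} s*s≈1 s′*s′≈1 = begin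
    (s * s′) * (s * s′) ≈⟨ solve 2 (λ a b → (a :* b) :* (a :* b) := (a :* a) :* (b :* b)) ≈.refl s s′ ⟩
    (s * s) * (s′ * s′) ≈⟨ *-cong s*s≈1 s′*s′≈1 ⟩
    1# * 1#             ≈⟨ *-identityˡ 1# ⟩
    1#                  ∎

  -1-involutory : - 1# * - 1# ≈ 1#
  -1-involutory = ≈.trans (-1*x≈-x (- 1#)) (-‿involutive 1#)

  -- The sign does not depend on β, so it cancels from a quotient of alternants.
  alternant-↭ : ∀ {xs ys} → xs ↭ ys → Σ[ s ∈ Carrier ] s * s ≈ 1# × Proportional s xs ys
  alternant-↭ {xs} {ys} (refl xs≋ys) = 1# , *-identityˡ 1# , λ p q β →
    ≈.trans (alternant-congˡ β (entry-cong xs≋ys p q))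
            (sym (*-identityˡ _))
  alternant-↭ (prep x≈y xs↭ys) =
    let s , s*s≈1 , s∣ = alternant-↭ xs↭ys in s , s*s≈1 , proportional-∷ x≈y s∣
  alternant-↭ {x ∷ x′ ∷ xs} (swap x≈y′ x′≈y xs↭ys) =
    let s , s*s≈1 , s∣ = alternant-↭ xs↭ys in
    - 1# * s , *-involutory -1-involutory s*s≈1 ,
    proportional-trans ≡.refl (proportional-swap x x′ xs)
                       (proportional-∷ x′≈y (proportional-∷ x≈y′ s∣))
  alternant-↭ {xs} {zs} (trans {ys = ys} xs↭ys ys↭zs) =
    let s  , s*s≈1   , s∣  = alternant-↭ xs↭ys
        s′ , s′*s′≈1 , s′∣ = alternant-↭ ys↭zs in
    s * s′ , *-involutory s*s≈1 s′*s′≈1 ,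
    proportional-trans {xs = xs} {ys} {zs} (xs↭ys⇒|xs|≡|ys| xs↭ys) s∣ s′∣

  -- The same formula as `δ` in the module `Φ`, so the two agree by unfolding; here only a
  -- commutative ring is at hand.
  staircase : ∀ {n} → Fin n → ℕ
  staircase j = toℕ (opposite j)

  -- The staircase has its own component because `staircase ∘ cast m≡n` does not unfold to the
  -- staircase of size `m`. Once `m≡n` is matched, both components are instances of `same`.
  alternant-tabulate-↭ : ∀ {m n} (m≡n : m ≡ n) (x : Fin m → Carrier) (y : Fin n → Carrier) →
    tabulate x ↭ tabulate y → Σ[ s ∈ Carrier ] s * s ≈ 1# ×
    (∀ β → alternant x (β ∘ cast m≡n) ≈ s * alternant y β) ×
    alternant x staircase ≈ s * alternant y staircase
  alternant-tabulate-↭ ≡.refl x y x↭y =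
    let s , s*s≈1 , s∣ = alternant-↭ x↭y
        same : ∀ β → alternant x β ≈ s * alternant y β
        same β = begin
          alternant x β
            ≈⟨ alternant-congˡ β (λ i → reflexive (List.lookup-tabulate x i)) ⟨
          alternant (entry (tabulate x) (≡.sym (List.length-tabulate x))) β
            ≈⟨ s∣ (≡.sym (List.length-tabulate x)) (≡.sym (List.length-tabulate y)) β ⟩
          s * alternant (entry (tabulate y) (≡.sym (List.length-tabulate y))) β
            ≈⟨ *-congˡ (alternant-congˡ β (λ i → reflexive (List.lookup-tabulate y i))) ⟩
          s * alternant y β ∎
    in s , s*s≈1 ,
       (λ β → ≈.trans (alternant-congʳ x (λ j → ≡.cong β (Fin.cast-is-id ≡.refl j))) (same β)) ,
       same staircase

  -- Interpolation and the regularity of Vandermonde determinants.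

  -- A certificate that the function `P` is polynomial of degree at most n with coefficient `a`
  -- (possibly zero) at yⁿ. Lower coefficients are hidden, since the interpolation argument follows
  -- only the leading one.
  data Polynomial : ℕ → Carrier → (Carrier → Carrier) → Set (c ⊔ ℓ) where
    constant : ∀ {a P} → (∀ y → P y ≈ a) → Polynomial 0 a P
    leading  : ∀ {n a b P Q} → (∀ y → P y ≈ a * y ^ suc n + Q y) → Polynomial n b Q →
               Polynomial (suc n) a P

  polynomial-+ : ∀ {n a b P Q} → Polynomial n a P → Polynomial n b Q →
                 Polynomial n (a + b) (λ y → P y + Q y)
  polynomial-+ (constant P≈a) (constant Q≈b) = constant λ y → +-cong (P≈a y) (Q≈b y)
  polynomial-+ (leading P≈ p) (leading Q≈ q) =
    leading (λ y → ≈.trans (+-cong (P≈ y) (Q≈ y))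
      (solve 5 (λ a y p b q → (a :* y :+ p) :+ (b :* y :+ q) := (a :+ b) :* y :+ (p :+ q))
             ≈.refl _ _ _ _ _))
      (polynomial-+ p q)

  -- a (yⁿ⁺¹ - xⁿ⁺¹) / (y - x)
  quotient : ℕ → Carrier → Carrier → Carrier → Carrier
  quotient zero    a x y = a
  quotient (suc n) a x y = a * y ^ suc n + quotient n (a * x) x y

  polynomial-quotient : ∀ n a x → Polynomial n a (quotient n a x)
  polynomial-quotient zero    a x = constant λ y → ≈.refl
  polynomial-quotient (suc n) a x = leading (λ y → ≈.refl) (polynomial-quotient n (a * x) x)

  -- The factorisations below are stated without subtraction:
  -- P y + x Q y ≈ P x + y Q y says that P y - P x is (y - x) Q y.
  quotient-factors : ∀ n a x y → a * y ^ suc n + x * quotient n a x y ≈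
                                 a * x ^ suc n + y * quotient n a x y
  quotient-factors zero    a x y =
    ≈.trans (+-cong (*-congˡ (*-identityʳ y)) (*-comm x a))
    (≈.trans (+-comm _ _) (+-cong (*-congˡ (sym (*-identityʳ x))) (*-comm a y)))
  quotient-factors (suc n) a x y = begin
    a * (y * y ^ suc n) + x * (a * y ^ suc n + q)
      ≈⟨ solve 5 (λ a x y p q → a :* (y :* p) :+ x :* (a :* p :+ q)
                                   := y :* (a :* p) :+ (a :* x :* p :+ x :* q)) ≈.refl a x y _ q ⟩
    y * (a * y ^ suc n) + (a * x * y ^ suc n + x * q)
      ≈⟨ +-congˡ (quotient-factors n (a * x) x y) ⟩
    y * (a * y ^ suc n) + (a * x * x ^ suc n + y * q)
      ≈⟨ solve 6 (λ a x y p r q → y :* (a :* p) :+ (a :* x :* r :+ y :* q)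
                                   := a :* (x :* r) :+ y :* (a :* p :+ q)) ≈.refl a x y _ _ q ⟩
    a * (x * x ^ suc n) + y * (a * y ^ suc n + q) ∎
    where q = quotient n (a * x) x y

  -- Division by `y - x`, one monomial at a time. The quotient keeps the leading coefficient `a`
  -- while the degree drops by one, which is what the induction in `leading-coefficient-vanishes`
  -- lives on.
  polynomial-factor : ∀ {n a P} → Polynomial (suc n) a P → ∀ x →
                      ∃[ Q ] Polynomial n a Q × (∀ y → P y + x * Q y ≈ P x + y * Q y)
  polynomial-factor {zero} {a} (leading {b = b} {P = P} P≈ (constant Q≈b)) x =
    quotient 0 a x , polynomial-quotient 0 a x , λ y → begin
      P y + x * a                ≈⟨ +-congʳ (≈.trans (P≈ y) (+-congˡ (Q≈b y))) ⟩
      a * y ^ 1 + b + x * a      ≈⟨ solve 3 (λ u v w → u :+ v :+ w := u :+ w :+ v) ≈.refl _ _ _ ⟩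
      a * y ^ 1 + x * a + b      ≈⟨ +-congʳ (quotient-factors 0 a x y) ⟩
      a * x ^ 1 + y * a + b      ≈⟨ solve 3 (λ u v w → u :+ v :+ w := u :+ w :+ v) ≈.refl _ _ _ ⟩
      a * x ^ 1 + b + y * a      ≈⟨ +-congʳ (≈.trans (P≈ x) (+-congˡ (Q≈b x))) ⟨
      P x + y * a                ∎
  polynomial-factor {suc n} {a} (leading {P = P} {Q = Q} P≈ q) x =
    let Q′ , q′ , factors = polynomial-factor q x in
    (λ y → quotient (suc n) a x y + Q′ y) ,
    leading (λ y → +-assoc _ _ _) (polynomial-+ (polynomial-quotient n (a * x) x) q′) ,
    λ y → let R = quotient (suc n) a x y in begin
      P y + x * (R + Q′ y)
        ≈⟨ +-congʳ (P≈ y) ⟩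
      a * y ^ suc (suc n) + Q y + x * (R + Q′ y)
        ≈⟨ regroup _ _ _ _ _ ⟩
      a * y ^ suc (suc n) + x * R + (Q y + x * Q′ y)
        ≈⟨ +-cong (quotient-factors (suc n) a x y) (factors y) ⟩
      a * x ^ suc (suc n) + y * R + (Q x + y * Q′ y)
        ≈⟨ regroup _ _ _ _ _ ⟨
      a * x ^ suc (suc n) + Q x + y * (R + Q′ y)
        ≈⟨ +-congʳ (P≈ x) ⟨
      P x + y * (R + Q′ y) ∎
    where
    regroup : ∀ u v w r s → u + v + w * (r + s) ≈ u + w * r + (v + w * s)
    regroup = solve 5 (λ u v w r s → u :+ v :+ w :* (r :+ s) := u :+ w :* r :+ (v :+ w :* s)) ≈.refl

  -- x - y is not a zero divisor, again without subtraction.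
  Separated : Carrier → Carrier → Set (c ⊔ ℓ)
  Separated x y = ∀ h → h * x ≈ h * y → h ≈ 0#

  PairwiseSeparated : ∀ {n} → (Fin n → Carrier) → Set (c ⊔ ℓ)
  PairwiseSeparated x = ∀ {i j} → i ≢ j → Separated (x i) (x j)

  -- Induction on the degree, splitting off the root `x zero`. At every other point `y` the
  -- factorisation leaves `h * Q y * x zero ≈ h * Q y * y`, and separation of the points gives
  -- `h * Q y ≈ 0#`. The ring may have zero divisors, so `h` is carried along instead of being
  -- cancelled.
  leading-coefficient-vanishes : ∀ {n a P} → Polynomial n a P → ∀ h (x : Fin (suc n) → Carrier) →
    PairwiseSeparated x → (∀ i → h * P (x i) ≈ 0#) → h * a ≈ 0#
  leading-coefficient-vanishes {zero} (constant P≈a) h x sep roots =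
    ≈.trans (*-congˡ (sym (P≈a (x zero)))) (roots zero)
  leading-coefficient-vanishes {suc n} {P = P} p h x sep roots =
    let Q , q , factors = polynomial-factor p (x zero) in
    leading-coefficient-vanishes q h (x ∘ suc) (λ i≢j → sep (i≢j ∘ Fin.suc-injective)) λ i →
      sep {zero} {suc i} (λ ()) _ $ begin
        h * Q (x (suc i)) * x zero       ≈⟨ +-identityˡ _ ⟨
        0# + h * Q (x (suc i)) * x zero  ≈⟨ +-congʳ (roots (suc i)) ⟨
        h * P (x (suc i)) + h * Q (x (suc i)) * x zero
          ≈⟨ collect _ _ _ _ ⟨
        h * (P (x (suc i)) + x zero * Q (x (suc i)))
          ≈⟨ *-congˡ (factors (x (suc i))) ⟩
        h * (P (x zero) + x (suc i) * Q (x (suc i)))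
          ≈⟨ collect _ _ _ _ ⟩
        h * P (x zero) + h * Q (x (suc i)) * x (suc i)
          ≈⟨ +-congʳ (roots zero) ⟩
        0# + h * Q (x (suc i)) * x (suc i) ≈⟨ +-identityˡ _ ⟩
        h * Q (x (suc i)) * x (suc i) ∎
    where
    collect : ∀ h p x q → h * (p + x * q) ≈ h * p + h * q * x
    collect = solve 4 (λ h p x q → h :* (p :+ x :* q) := h :* p :+ h :* q :* x) ≈.refl

  staircase-suc : ∀ {n} (j : Fin n) → staircase (suc j) ≡ staircase j
  staircase-suc j = Fin.toℕ-inject₁ (opposite j)

  -- Staircase exponents descend from n to 0, so column `zero` carries the leading coefficient.
  polynomial-sum : ∀ n (s m : Fin (suc n) → Carrier) →
                   Polynomial n (s zero * m zero) (λ y → sum λ j → s j * y ^ staircase j * m j)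
  polynomial-sum zero    s m = constant λ y →
    ≈.trans (+-identityʳ _) (*-congʳ (*-identityʳ _))
  polynomial-sum (suc n) s m = leading
    (λ y → +-cong
      (begin
        s zero * y ^ toℕ (fromℕ (suc n)) * m zero
          ≈⟨ *-congʳ (*-congˡ (^-cong {x = y} ≈.refl (Fin.toℕ-fromℕ (suc n)))) ⟩
        s zero * y ^ suc n * m zero
          ≈⟨ solve 3 (λ s y m → s :* y :* m := s :* m :* y) ≈.refl _ _ _ ⟩
        s zero * m zero * y ^ suc n ∎)
      (sum-cong _ (λ j → s (suc j) * y ^ staircase j * m (suc j)) λ j →
        *-congʳ (*-congˡ (^-cong {x = y} ≈.refl (staircase-suc j)))))
    (polynomial-sum n (s ∘ suc) (m ∘ suc))

  -- Expanding along the first row gives a polynomial of degree n in the first point, with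
  -- the smaller Vandermonde determinant as leading coefficient.  After multiplication by h
  -- it vanishes at all n + 1 points.
  vandermonde-regular : ∀ {n} (x : Fin n → Carrier) → PairwiseSeparated x →
                        ∀ h → h * alternant x staircase ≈ 0# → h ≈ 0#
  vandermonde-regular {zero} x sep h h*1≈0 = ≈.trans (sym (*-identityʳ h)) h*1≈0
  vandermonde-regular {suc n} x sep h h*V≈0 =
    vandermonde-regular (x ∘ suc) (λ i≢j → sep (i≢j ∘ Fin.suc-injective)) h $ begin
      h * alternant (x ∘ suc) staircase ≈⟨ *-congˡ (≈.trans (*-identityˡ _) m₀≈) ⟨
      h * (1# * m zero)
        ≈⟨ leading-coefficient-vanishes (polynomial-sum n (sign ∘ toℕ) m) h x sep roots ⟩
      0# ∎
    where
    M : Matrix (suc n)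
    M i j = x i ^ staircase j
    m : Fin (suc n) → Carrier
    m j = det (minor M j)
    m₀≈ : m zero ≈ alternant (x ∘ suc) staircase
    m₀≈ = det-cong (minor M zero) (λ i j → x (suc i) ^ staircase j)
      λ i j → ^-cong {x = x (suc i)} ≈.refl (staircase-suc j)
    replaceFirst : Carrier → Matrix (suc n)
    replaceFirst y zero    j = y ^ staircase j
    replaceFirst y (suc i) j = M (suc i) j
    roots : ∀ i → h * sum (λ j → sign (toℕ j) * x i ^ staircase j * m j) ≈ 0#
    roots zero    = h*V≈0
    -- The minors `m` omit the first row, so the sum is the determinant of
    -- `replaceFirst (x (suc i))`, whose rows `zero` and `suc i` coincide.
    roots (suc i) = ≈.trans (*-congˡ (det-equal-rows (replaceFirst (x (suc i))) i λ j → ≈.refl)) (zeroʳ h)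

-- Quotients of alternants under a ring homomorphism.

module DeterminantHomomorphism {c₁ ℓ₁ c₂ ℓ₂} (R : CommutativeRing c₁ ℓ₁) (S : CommutativeRing c₂ ℓ₂)
  {⟦_⟧ : CommutativeRing.Carrier R → CommutativeRing.Carrier S}
  (⟦⟧-isRingHomomorphism :
    RingMorphisms.IsRingHomomorphism (CommutativeRing.rawRing R) (CommutativeRing.rawRing S) ⟦_⟧) where
  private
    module R = CommutativeRing R
    module S = CommutativeRing S
  open RingMorphisms.IsRingHomomorphism ⟦⟧-isRingHomomorphism
  private
    module DR = Determinant R.rawRing
    module DS = Determinant S.rawRing
    module PR = DeterminantProperties R
    module PS = DeterminantProperties S
  open import Algebra.Properties.Semiring.Exp R.semiring using () renaming (_^_ to _^R_)
  open import Algebra.Properties.Semiring.Exp S.semiring using (^-congˡ) renaming (_^_ to _^S_)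
  open import Algebra.Properties.Semiring.Sum R.semiring using () renaming (sum to sumR)
  open import Algebra.Properties.Semiring.Sum S.semiring using () renaming (sum to sumS)

  ^-homo : ∀ x n → ⟦ x ^R n ⟧ S.≈ ⟦ x ⟧ ^S n
  ^-homo x zero    = 1#-homo
  ^-homo x (suc n) = S.trans (*-homo x (x ^R n)) (S.*-congˡ (^-homo x n))

  sum-homo : ∀ {n} (f : Fin n → R.Carrier) → ⟦ sumR f ⟧ S.≈ sumS (λ i → ⟦ f i ⟧)
  sum-homo {zero}  f = 0#-homo
  sum-homo {suc n} f = S.trans (+-homo (f zero) _) (S.+-congˡ (sum-homo (f ∘ suc)))

  sign-homo : ∀ n → ⟦ PR.sign n ⟧ S.≈ PS.sign n
  sign-homo n = S.trans (^-homo (R.- R.1#) n)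
                        (^-congˡ n (S.trans (-‿homo R.1#) (S.-‿cong 1#-homo)))

  det-homo : ∀ {n} (M : PR.Matrix n) → ⟦ DR.det M ⟧ S.≈ DS.det (λ i j → ⟦ M i j ⟧)
  det-homo {zero}  M = 1#-homo
  det-homo {suc n} M = S.trans (sum-homo (PR.cofactorTerm M)) $
    PS.sum-cong (λ j → ⟦ PR.cofactorTerm M j ⟧) (PS.cofactorTerm (λ i j → ⟦ M i j ⟧)) λ j →
      S.trans (*-homo (PR.sign (toℕ j) R.* M zero j) (DR.det (PR.minor M j)))
              (S.*-cong (S.trans (*-homo (PR.sign (toℕ j)) (M zero j)) (S.*-congʳ (sign-homo (toℕ j))))
                        (det-homo (PR.minor M j)))

  alternant-homo : ∀ {n} (x : Fin n → R.Carrier) (β : Fin n → ℕ) →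
                   ⟦ DR.alternant x β ⟧ S.≈ DS.alternant (λ i → ⟦ x i ⟧) β
  alternant-homo x β = S.trans (det-homo (λ i j → x i ^R β j))
    (PS.det-cong (λ i j → ⟦ x i ^R β j ⟧) (λ i j → ⟦ x i ⟧ ^S β j) λ i j → ^-homo (x i) (β j))

  open Permutation S.setoid using (_↭_)

  -- Neither quotient is computed. The equation for `g` is carried over by the homomorphism and
  -- compared with the one for `f`. The sizes of the two families of points agree only up to the
  -- equation `k≡n`, whence the `cast` in the exponents.
  alternant-quotient-homo : ∀ {k n} (k≡n : k ≡ n) (x : Fin k → R.Carrier) (y : Fin n → S.Carrier) →
    tabulate (λ i → ⟦ x i ⟧) ↭ tabulate y → PS.PairwiseSeparated y → ∀ β f g →
    f S.* DS.alternant y PS.staircase S.≈ DS.alternant y β →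
    g R.* DR.alternant x PR.staircase R.≈ DR.alternant x (β ∘ cast k≡n) →
    f S.≈ ⟦ g ⟧
  alternant-quotient-homo k≡n x y x↭y separated β f g fV≈A gV≈A = x∙y⁻¹≈ε⇒x≈y f ⟦ g ⟧ $
    PS.vandermonde-regular y separated (f S.- ⟦ g ⟧) $ begin
      (f S.- ⟦ g ⟧) S.* V        ≈⟨ [y-z]x≈yx-zx V f ⟦ g ⟧ ⟩
      f S.* V S.- ⟦ g ⟧ S.* V    ≈⟨ S.+-cong fV≈A (S.-‿cong ⟦g⟧V≈A) ⟩
      A S.- A                    ≈⟨ S.-‿inverseʳ A ⟩
      S.0#                       ∎
    where
    open import Algebra.Properties.Ring S.ring using ([y-z]x≈yx-zx; x∙y⁻¹≈ε⇒x≈y)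
    open import Relation.Binary.Reasoning.Setoid S.setoid
    V A : S.Carrier
    V = DS.alternant y PS.staircase
    A = DS.alternant y β
    permuted = PS.alternant-tabulate-↭ k≡n (λ i → ⟦ x i ⟧) y x↭y
    s : S.Carrier
    s = proj₁ permuted
    -- All that is known of `s` is that its square is 1, so it is removed by multiplying with it
    -- once more.
    cancel-s : ∀ h → s S.* (s S.* h) S.≈ h
    cancel-s h = S.trans (S.sym (S.*-assoc s s h))
      (S.trans (S.*-congʳ (proj₁ (proj₂ permuted))) (S.*-identityˡ h))
    ⟦g⟧[sV]≈sA : ⟦ g ⟧ S.* (s S.* V) S.≈ s S.* A
    ⟦g⟧[sV]≈sA = begin
      ⟦ g ⟧ S.* (s S.* V)                                      ≈⟨ S.*-congˡ (proj₂ (proj₂ (proj₂ permuted))) ⟨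
      ⟦ g ⟧ S.* DS.alternant (λ i → ⟦ x i ⟧) PS.staircase      ≈⟨ S.*-congˡ (alternant-homo x PR.staircase) ⟨
      ⟦ g ⟧ S.* ⟦ DR.alternant x PR.staircase ⟧                ≈⟨ *-homo g _ ⟨
      ⟦ g R.* DR.alternant x PR.staircase ⟧                    ≈⟨ ⟦⟧-cong gV≈A ⟩
      ⟦ DR.alternant x (β ∘ cast k≡n) ⟧                        ≈⟨ alternant-homo x (β ∘ cast k≡n) ⟩
      DS.alternant (λ i → ⟦ x i ⟧) (β ∘ cast k≡n)              ≈⟨ proj₁ (proj₂ (proj₂ permuted)) β ⟩
      s S.* A                                                  ∎
    ⟦g⟧V≈A : ⟦ g ⟧ S.* V S.≈ A
    ⟦g⟧V≈A = begin
      ⟦ g ⟧ S.* V                        ≈⟨ cancel-s _ ⟨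
      s S.* (s S.* (⟦ g ⟧ S.* V))        ≈⟨ S.*-congˡ (x∙yz≈y∙xz s ⟦ g ⟧ V) ⟩
      s S.* (⟦ g ⟧ S.* (s S.* V))        ≈⟨ S.*-congˡ ⟦g⟧[sV]≈sA ⟩
      s S.* (s S.* A)                    ≈⟨ cancel-s A ⟩
      A                                  ∎
      where open import Algebra.Properties.CommutativeSemigroup S.*-commutativeSemigroup using (x∙yz≈y∙xz)

-- Laurent polynomials as a commutative ring.

module LaurentProperties {c ℓ} (K : CommutativeRing c ℓ) where
  open CommutativeRing K hiding (zero)
  open LaurentPolynomials K
  open import Algebra.Properties.Ring ring using (-‿distribˡ-*; -‿+-comm; -0#≈0#; x∙y⁻¹≈ε⇒x≈y)
  open import Algebra.Solver.Ring.NaturalCoefficients.Default commutativeSemiring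
    using (solve; _:+_; _:*_; _:=_)
  open import Relation.Binary.Reasoning.Setoid setoid
  module L (r : ℕ) = RawRing (laurentRing r)

  private
    _≟_ : ∀ {r} (d e : Vec ℤ r) → _
    _≟_ = Vec.≡-dec ℤ._≟_

    variable
      r : ℕ

  infixl 6 _⊕_
  _⊕_ : Vec ℤ r → Vec ℤ r → Vec ℤ r
  _⊕_ = Vec.zipWith ℤ._+_

  -- The linear extension of φ from monomials to Laurent polynomials.
  ⟪_,_⟫ : Laurent r → (Vec ℤ r → Carrier) → Carrier
  ⟪ []          , φ ⟫ = 0#
  ⟪ (a , d) ∷ f , φ ⟫ = a * φ d + ⟪ f , φ ⟫

  indicator : Vec ℤ r → Vec ℤ r → Carrier
  indicator e d = if does (d ≟ e) then 1# else 0#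

  coeff≈⟪indicator⟫ : (f : Laurent r) (e : Vec ℤ r) → coeff f e ≈ ⟪ f , indicator e ⟫
  coeff≈⟪indicator⟫ []            e = refl
  coeff≈⟪indicator⟫ ((a , d) ∷ f) e with does (d ≟ e)
  ... | true  = +-cong (sym (*-identityʳ a)) (coeff≈⟪indicator⟫ f e)
  ... | false = trans (sym (+-identityˡ _)) (+-cong (sym (zeroʳ a)) (coeff≈⟪indicator⟫ f e))

  ⟪⟫-congʳ : ∀ (f : Laurent r) {φ ψ} → (∀ d → φ d ≈ ψ d) → ⟪ f , φ ⟫ ≈ ⟪ f , ψ ⟫
  ⟪⟫-congʳ []            φ≈ψ = refl
  ⟪⟫-congʳ ((a , d) ∷ f) φ≈ψ = +-cong (*-congˡ (φ≈ψ d)) (⟪⟫-congʳ f φ≈ψ)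

  ⟪⟫-++ : ∀ (f g : Laurent r) φ → ⟪ f ++ g , φ ⟫ ≈ ⟪ f , φ ⟫ + ⟪ g , φ ⟫
  ⟪⟫-++ []            g φ = sym (+-identityˡ _)
  ⟪⟫-++ ((a , d) ∷ f) g φ = trans (+-congˡ (⟪⟫-++ f g φ)) (sym (+-assoc _ _ _))

  ⟪⟫-neg : ∀ (f : Laurent r) φ → ⟪ L.-_ r f , φ ⟫ ≈ - ⟪ f , φ ⟫
  ⟪⟫-neg []            φ = sym -0#≈0#
  ⟪⟫-neg ((a , d) ∷ f) φ = trans (+-cong (sym (-‿distribˡ-* _ _)) (⟪⟫-neg f φ)) (-‿+-comm _ _)

  ⟪⟫-linear : ∀ (f : Laurent r) a φ ψ → ⟪ f , (λ d → a * φ d + ψ d) ⟫ ≈ a * ⟪ f , φ ⟫ + ⟪ f , ψ ⟫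
  ⟪⟫-linear []            a φ ψ = sym (trans (+-identityʳ _) (zeroʳ a))
  ⟪⟫-linear ((b , d) ∷ f) a φ ψ = trans (+-congˡ (⟪⟫-linear f a φ ψ))
    (solve 6 (λ a b p q s t → b :* (a :* p :+ q) :+ (a :* s :+ t) := a :* (b :* p :+ s) :+ (b :* q :+ t))
           refl a b _ _ _ _)

  ⟪⟫-zeroʳ : ∀ (f : Laurent r) → ⟪ f , (λ _ → 0#) ⟫ ≈ 0#
  ⟪⟫-zeroʳ []            = refl
  ⟪⟫-zeroʳ ((a , d) ∷ f) = trans (+-cong (zeroʳ a) (⟪⟫-zeroʳ f)) (+-identityˡ 0#)

  ⟪⟫-*ʳ : ∀ (f : Laurent r) a φ → ⟪ f , (λ d → a * φ d) ⟫ ≈ a * ⟪ f , φ ⟫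
  ⟪⟫-*ʳ f a φ = begin
    ⟪ f , (λ d → a * φ d) ⟫                  ≈⟨ ⟪⟫-congʳ f (λ d → +-identityʳ _) ⟨
    ⟪ f , (λ d → a * φ d + 0#) ⟫             ≈⟨ ⟪⟫-linear f a φ (λ _ → 0#) ⟩
    a * ⟪ f , φ ⟫ + ⟪ f , (λ _ → 0#) ⟫       ≈⟨ +-congˡ (⟪⟫-zeroʳ f) ⟩
    a * ⟪ f , φ ⟫ + 0#                       ≈⟨ +-identityʳ _ ⟩
    a * ⟪ f , φ ⟫                            ∎

  -- Fubini for finite sums; combined with `⟪⟫-*` it makes the product commutative.
  ⟪⟫-interchange : ∀ {s} (f : Laurent r) (g : Laurent s) (F : Vec ℤ r → Vec ℤ s → Carrier) →
    ⟪ f , (λ d → ⟪ g , F d ⟫) ⟫ ≈ ⟪ g , (λ e → ⟪ f , (λ d → F d e) ⟫) ⟫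
  ⟪⟫-interchange []            g F = sym (⟪⟫-zeroʳ g)
  ⟪⟫-interchange ((a , d) ∷ f) g F = begin
    a * ⟪ g , F d ⟫ + ⟪ f , (λ d → ⟪ g , F d ⟫) ⟫
      ≈⟨ +-congˡ (⟪⟫-interchange f g F) ⟩
    a * ⟪ g , F d ⟫ + ⟪ g , (λ e → ⟪ f , (λ d → F d e) ⟫) ⟫
      ≈⟨ ⟪⟫-linear g a (F d) _ ⟨
    ⟪ g , (λ e → a * F d e + ⟪ f , (λ d → F d e) ⟫) ⟫ ∎

  ⟪⟫-map : ∀ {s} (ψ : Vec ℤ r → Carrier) (θ : Vec ℤ r → Vec ℤ s) (f : Laurent r) φ →
    ⟪ List.map (λ (a , e) → a * ψ e , θ e) f , φ ⟫ ≈ ⟪ f , (λ e → ψ e * φ (θ e)) ⟫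
  ⟪⟫-map ψ θ []            φ = refl
  ⟪⟫-map ψ θ ((a , d) ∷ f) φ = +-cong (*-assoc _ _ _) (⟪⟫-map ψ θ f φ)

  ⟪⟫-scale : ∀ a d (g : Laurent r) φ →
    ⟪ List.map (λ (b , e) → a * b , d ⊕ e) g , φ ⟫ ≈ a * ⟪ g , (λ e → φ (d ⊕ e)) ⟫
  ⟪⟫-scale a d []            φ = sym (zeroʳ a)
  ⟪⟫-scale a d ((b , e) ∷ g) φ =
    trans (+-cong (*-assoc _ _ _) (⟪⟫-scale a d g φ)) (sym (distribˡ a _ _))

  ⟪⟫-* : ∀ (f g : Laurent r) φ → ⟪ L._*_ r f g , φ ⟫ ≈ ⟪ f , (λ d → ⟪ g , (λ e → φ (d ⊕ e)) ⟫) ⟫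
  ⟪⟫-* []            g φ = refl
  ⟪⟫-* ((a , d) ∷ f) g φ = trans (⟪⟫-++ (List.map (λ (b , e) → a * b , d ⊕ e) g) _ φ)
    (+-cong (⟪⟫-scale a d g φ) (⟪⟫-* f g φ))

  delete : Vec ℤ r → Laurent r → Laurent r
  delete d []            = []
  delete d ((a , e) ∷ f) = if does (e ≟ d) then delete d f else (a , e) ∷ delete d f

  length-delete : ∀ (d : Vec ℤ r) f → length (delete d f) ℕ.≤ length f
  length-delete d []            = ℕ.z≤n
  length-delete d ((a , e) ∷ f) with does (e ≟ d)
  ... | true  = ℕ.m≤n⇒m≤1+n (length-delete d f)
  ... | false = ℕ.s≤s (length-delete d f)

  -- All terms of exponent `d` are gathered into one, whose coefficient is `coeff f d`.
  ⟪⟫-delete : ∀ (d : Vec ℤ r) f φ → ⟪ f , φ ⟫ ≈ coeff f d * φ d + ⟪ delete d f , φ ⟫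
  ⟪⟫-delete d []            φ = sym (trans (+-identityʳ _) (zeroˡ _))
  ⟪⟫-delete d ((a , e) ∷ f) φ with e ≟ d
  ... | yes ≡.refl = trans (+-congˡ (⟪⟫-delete d f φ))
    (solve 4 (λ a p c t → a :* p :+ (c :* p :+ t) := (a :+ c) :* p :+ t) refl _ _ _ _)
  ... | no _ = trans (+-congˡ (⟪⟫-delete d f φ))
    (solve 3 (λ x y z → x :+ (y :+ z) := y :+ (x :+ z)) refl _ _ _)

  coeff-delete-self : ∀ (d : Vec ℤ r) f → coeff (delete d f) d ≈ 0#
  coeff-delete-self d []            = refl
  coeff-delete-self d ((a , e) ∷ f) with e ≟ d in eq
  ... | yes _ = coeff-delete-self d f
  ... | no  _ rewrite eq = coeff-delete-self d f

  coeff-delete-other : ∀ (d : Vec ℤ r) f {e} → d ≢ e → coeff (delete d f) e ≈ coeff f e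
  coeff-delete-other d []             d≢e = refl
  coeff-delete-other d ((a , d′) ∷ f) {e} d≢e with d′ ≟ d | d′ ≟ e in eq
  ... | yes ≡.refl | yes d≡e = contradiction d≡e d≢e
  ... | yes _      | no  _   = coeff-delete-other d f d≢e
  ... | no _       | yes _   rewrite eq = +-congˡ (coeff-delete-other d f d≢e)
  ... | no _       | no  _   rewrite eq = coeff-delete-other d f d≢e

  -- Terms sharing the exponent of the first one cancel, so they can be deleted together.
  ⟪⟫-zeroˡ : ∀ n (f : Laurent r) → length f ℕ.≤ n → f ≈ᴸ [] → ∀ φ → ⟪ f , φ ⟫ ≈ 0#
  ⟪⟫-zeroˡ n       []             _   f≈0 φ = refl
  -- The recursion runs on the bound `n`, because `delete d f` is not a sublist that pattern
  -- matching exposes. It is strictly shorter than `f`, since the head has exponent `d`.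
  ⟪⟫-zeroˡ (suc n) f@((a , d) ∷ f′) (ℕ.s≤s len) f≈0 φ = begin
    ⟪ f , φ ⟫                             ≈⟨ ⟪⟫-delete d f φ ⟩
    coeff f d * φ d + ⟪ delete d f , φ ⟫  ≈⟨ +-cong (trans (*-congʳ (f≈0 d)) (zeroˡ _))
                                                   (⟪⟫-zeroˡ n (delete d f) shorter deleted≈0 φ) ⟩
    0# + 0#                               ≈⟨ +-identityˡ 0# ⟩
    0#                                    ∎
    where
    shorter : length (delete d f) ℕ.≤ n
    shorter with d ≟ d
    ... | yes _   = ℕ.≤-trans (length-delete d f′) len
    ... | no d≢d = contradiction ≡.refl d≢d
    deleted≈0 : delete d f ≈ᴸ []
    deleted≈0 e with d ≟ e
    ... | yes ≡.refl = coeff-delete-self d f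
    ... | no d≢e     = trans (coeff-delete-other d f d≢e) (f≈0 e)

  infix 4 _≋_
  -- Coefficientwise equality tests only the functions `indicator e`. Testing every `φ` is easier to
  -- work with, since multiplying or substituting merely replaces `φ` by another function; the next
  -- two lemmas show that the two equalities coincide.
  _≋_ : Laurent r → Laurent r → Set (c ⊔ ℓ)
  f ≋ g = ∀ φ → ⟪ f , φ ⟫ ≈ ⟪ g , φ ⟫

  ≋⇒≈ᴸ : {f g : Laurent r} → f ≋ g → f ≈ᴸ g
  ≋⇒≈ᴸ {f = f} {g} f≋g e = trans (coeff≈⟪indicator⟫ f e) (trans (f≋g (indicator e)) (sym (coeff≈⟪indicator⟫ g e)))

  -- All coefficients of `f - g` are zero, so the claim reduces to `⟪⟫-zeroˡ` for a single list.
  ≈ᴸ⇒≋ : {f g : Laurent r} → f ≈ᴸ g → f ≋ g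
  ≈ᴸ⇒≋ {r} {f} {g} f≈g φ = x∙y⁻¹≈ε⇒x≈y _ _ $ begin
    ⟪ f , φ ⟫ - ⟪ g , φ ⟫              ≈⟨ difference φ ⟨
    ⟪ f ++ L.-_ r g , φ ⟫              ≈⟨ ⟪⟫-zeroˡ _ (f ++ L.-_ r g) ℕ.≤-refl vanishes φ ⟩
    0#                                 ∎
    where
    difference : ∀ φ → ⟪ f ++ L.-_ r g , φ ⟫ ≈ ⟪ f , φ ⟫ - ⟪ g , φ ⟫
    difference φ = trans (⟪⟫-++ f _ φ) (+-congˡ (⟪⟫-neg g φ))
    vanishes : f ++ L.-_ r g ≈ᴸ []
    vanishes e = begin
      coeff (f ++ L.-_ r g) e             ≈⟨ coeff≈⟪indicator⟫ (f ++ L.-_ r g) e ⟩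
      ⟪ f ++ L.-_ r g , indicator e ⟫     ≈⟨ difference (indicator e) ⟩
      ⟪ f , indicator e ⟫ - ⟪ g , indicator e ⟫
        ≈⟨ +-cong (coeff≈⟪indicator⟫ f e) (-‿cong (coeff≈⟪indicator⟫ g e)) ⟨
      coeff f e - coeff g e               ≈⟨ +-congʳ (f≈g e) ⟩
      coeff g e - coeff g e               ≈⟨ -‿inverseʳ _ ⟩
      0#                                  ∎

  ≈ᴸ-isEquivalence : IsEquivalence (_≈ᴸ_ {r})
  ≈ᴸ-isEquivalence = record
    { refl = λ e → refl ; sym = λ p e → sym (p e) ; trans = λ p q e → trans (p e) (q e) }

  private
    0ᵥ : Vec ℤ r
    0ᵥ = Vec.replicate _ 0ℤ

  ⊕-comm : (d e : Vec ℤ r) → d ⊕ e ≡ e ⊕ d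
  ⊕-comm = Vec.zipWith-comm ℤ.+-comm

  ⊕-assoc : (d e f : Vec ℤ r) → (d ⊕ e) ⊕ f ≡ d ⊕ (e ⊕ f)
  ⊕-assoc = Vec.zipWith-assoc ℤ.+-assoc

  ⊕-identityˡ : (d : Vec ℤ r) → 0ᵥ ⊕ d ≡ d
  ⊕-identityˡ = Vec.zipWith-identityˡ ℤ.+-identityˡ

  module _ {r : ℕ} where
    open L r using () renaming (_+_ to _+ᴸ_; _*_ to _*ᴸ_; -_ to -ᴸ_; 1# to 1ᴸ)

    +ᴸ-cong : ∀ f f′ g g′ → f ≈ᴸ f′ → g ≈ᴸ g′ → f +ᴸ g ≈ᴸ f′ +ᴸ g′
    +ᴸ-cong f f′ g g′ f≈f′ g≈g′ = ≋⇒≈ᴸ {f = f +ᴸ g} {f′ +ᴸ g′} λ φ → begin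
      ⟪ f +ᴸ g , φ ⟫            ≈⟨ ⟪⟫-++ f g φ ⟩
      ⟪ f , φ ⟫ + ⟪ g , φ ⟫     ≈⟨ +-cong (≈ᴸ⇒≋ {f = f} {f′} f≈f′ φ) (≈ᴸ⇒≋ {f = g} {g′} g≈g′ φ) ⟩
      ⟪ f′ , φ ⟫ + ⟪ g′ , φ ⟫   ≈⟨ ⟪⟫-++ f′ g′ φ ⟨
      ⟪ f′ +ᴸ g′ , φ ⟫          ∎

    +ᴸ-comm : ∀ f g → f +ᴸ g ≈ᴸ g +ᴸ f
    +ᴸ-comm f g = ≋⇒≈ᴸ {f = f +ᴸ g} {g +ᴸ f} λ φ →
      trans (⟪⟫-++ f g φ) (trans (+-comm _ _) (sym (⟪⟫-++ g f φ)))

    -ᴸ-cong : ∀ f g → f ≈ᴸ g → -ᴸ f ≈ᴸ -ᴸ g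
    -ᴸ-cong f g f≈g = ≋⇒≈ᴸ {f = -ᴸ f} { -ᴸ g} λ φ →
      trans (⟪⟫-neg f φ) (trans (-‿cong (≈ᴸ⇒≋ {f = f} {g} f≈g φ)) (sym (⟪⟫-neg g φ)))

    -ᴸ-inverseʳ : ∀ f → f +ᴸ -ᴸ f ≈ᴸ []
    -ᴸ-inverseʳ f = ≋⇒≈ᴸ {f = f +ᴸ -ᴸ f} {[]} λ φ →
      trans (⟪⟫-++ f (-ᴸ f) φ) (trans (+-congˡ (⟪⟫-neg f φ)) (-‿inverseʳ _))

    *ᴸ-cong : ∀ f f′ g g′ → f ≈ᴸ f′ → g ≈ᴸ g′ → f *ᴸ g ≈ᴸ f′ *ᴸ g′
    *ᴸ-cong f f′ g g′ f≈f′ g≈g′ = ≋⇒≈ᴸ {f = f *ᴸ g} {f′ *ᴸ g′} λ φ → begin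
      ⟪ f *ᴸ g , φ ⟫
        ≈⟨ ⟪⟫-* f g φ ⟩
      ⟪ f , (λ d → ⟪ g , (λ e → φ (d ⊕ e)) ⟫) ⟫
        ≈⟨ ⟪⟫-congʳ f (λ d → ≈ᴸ⇒≋ {f = g} {g′} g≈g′ _) ⟩
      ⟪ f , (λ d → ⟪ g′ , (λ e → φ (d ⊕ e)) ⟫) ⟫
        ≈⟨ ≈ᴸ⇒≋ {f = f} {f′} f≈f′ _ ⟩
      ⟪ f′ , (λ d → ⟪ g′ , (λ e → φ (d ⊕ e)) ⟫) ⟫
        ≈⟨ ⟪⟫-* f′ g′ φ ⟨
      ⟪ f′ *ᴸ g′ , φ ⟫ ∎

    *ᴸ-comm : ∀ f g → f *ᴸ g ≈ᴸ g *ᴸ f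
    *ᴸ-comm f g = ≋⇒≈ᴸ {f = f *ᴸ g} {g *ᴸ f} λ φ → begin
      ⟪ f *ᴸ g , φ ⟫
        ≈⟨ ⟪⟫-* f g φ ⟩
      ⟪ f , (λ d → ⟪ g , (λ e → φ (d ⊕ e)) ⟫) ⟫
        ≈⟨ ⟪⟫-interchange f g (λ d e → φ (d ⊕ e)) ⟩
      ⟪ g , (λ e → ⟪ f , (λ d → φ (d ⊕ e)) ⟫) ⟫
        ≈⟨ ⟪⟫-congʳ g (λ e → ⟪⟫-congʳ f λ d → reflexive (≡.cong φ (⊕-comm d e))) ⟩
      ⟪ g , (λ e → ⟪ f , (λ d → φ (e ⊕ d)) ⟫) ⟫
        ≈⟨ ⟪⟫-* g f φ ⟨
      ⟪ g *ᴸ f , φ ⟫ ∎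

    *ᴸ-assoc : ∀ f g h → (f *ᴸ g) *ᴸ h ≈ᴸ f *ᴸ (g *ᴸ h)
    *ᴸ-assoc f g h = ≋⇒≈ᴸ {f = (f *ᴸ g) *ᴸ h} {f *ᴸ (g *ᴸ h)} λ φ → begin
      ⟪ (f *ᴸ g) *ᴸ h , φ ⟫
        ≈⟨ ⟪⟫-* (f *ᴸ g) h φ ⟩
      ⟪ f *ᴸ g , (λ d → ⟪ h , (λ e → φ (d ⊕ e)) ⟫) ⟫
        ≈⟨ ⟪⟫-* f g (λ d → ⟪ h , (λ e → φ (d ⊕ e)) ⟫) ⟩
      ⟪ f , (λ d → ⟪ g , (λ d′ → ⟪ h , (λ e → φ ((d ⊕ d′) ⊕ e)) ⟫) ⟫) ⟫
        ≈⟨ ⟪⟫-congʳ f (λ d → ⟪⟫-congʳ g λ d′ → ⟪⟫-congʳ h λ e → reflexive (≡.cong φ (⊕-assoc d d′ e))) ⟩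
      ⟪ f , (λ d → ⟪ g , (λ d′ → ⟪ h , (λ e → φ (d ⊕ (d′ ⊕ e))) ⟫) ⟫) ⟫
        ≈⟨ ⟪⟫-congʳ f (λ d → ⟪⟫-* g h (λ e → φ (d ⊕ e))) ⟨
      ⟪ f , (λ d → ⟪ g *ᴸ h , (λ e → φ (d ⊕ e)) ⟫) ⟫
        ≈⟨ ⟪⟫-* f (g *ᴸ h) φ ⟨
      ⟪ f *ᴸ (g *ᴸ h) , φ ⟫ ∎

    *ᴸ-identityˡ : ∀ f → 1ᴸ *ᴸ f ≈ᴸ f
    *ᴸ-identityˡ f = ≋⇒≈ᴸ {f = 1ᴸ *ᴸ f} {f} λ φ → begin
      ⟪ 1ᴸ *ᴸ f , φ ⟫                       ≈⟨ ⟪⟫-* 1ᴸ f φ ⟩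
      1# * ⟪ f , (λ e → φ (0ᵥ ⊕ e)) ⟫ + 0#  ≈⟨ trans (+-identityʳ _) (*-identityˡ _) ⟩
      ⟪ f , (λ e → φ (0ᵥ ⊕ e)) ⟫            ≈⟨ ⟪⟫-congʳ f (λ e → reflexive (≡.cong φ (⊕-identityˡ e))) ⟩
      ⟪ f , φ ⟫                             ∎

    *ᴸ-distribʳ : ∀ h f g → (f +ᴸ g) *ᴸ h ≈ᴸ (f *ᴸ h) +ᴸ (g *ᴸ h)
    *ᴸ-distribʳ h f g = ≋⇒≈ᴸ {f = (f +ᴸ g) *ᴸ h} {(f *ᴸ h) +ᴸ (g *ᴸ h)} λ φ → begin
      ⟪ (f +ᴸ g) *ᴸ h , φ ⟫                  ≈⟨ ⟪⟫-* (f +ᴸ g) h φ ⟩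
      ⟪ f +ᴸ g , _ ⟫                         ≈⟨ ⟪⟫-++ f g (λ d → ⟪ h , (λ e → φ (d ⊕ e)) ⟫) ⟩
      ⟪ f , _ ⟫ + ⟪ g , _ ⟫                  ≈⟨ +-cong (⟪⟫-* f h φ) (⟪⟫-* g h φ) ⟨
      ⟪ f *ᴸ h , φ ⟫ + ⟪ g *ᴸ h , φ ⟫        ≈⟨ ⟪⟫-++ (f *ᴸ h) (g *ᴸ h) φ ⟨
      ⟪ (f *ᴸ h) +ᴸ (g *ᴸ h) , φ ⟫           ∎

    private
      transᴸ : ∀ {f g h : Laurent r} → f ≈ᴸ g → g ≈ᴸ h → f ≈ᴸ h
      transᴸ p q e = trans (p e) (q e)

    laurent-isCommutativeRing : IsCommutativeRing _≈ᴸ_ _+ᴸ_ _*ᴸ_ -ᴸ_ [] 1ᴸ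
    laurent-isCommutativeRing = record
      { isRing = record
        { +-isAbelianGroup = record
          { isGroup = record
            { isMonoid = record
              { isSemigroup = record
                { isMagma = record
                  { isEquivalence = ≈ᴸ-isEquivalence
                  ; ∙-cong        = λ {f} {f′} {g} {g′} → +ᴸ-cong f f′ g g′
                  }
                ; assoc = λ f g h e → reflexive (≡.cong (λ f → coeff f e) (List.++-assoc f g h))
                }
              ; identity = (λ f e → refl)
                         , λ f e → reflexive (≡.cong (λ f → coeff f e) (List.++-identityʳ f))
              }
            ; inverse = (λ f → transᴸ {(-ᴸ f) +ᴸ f} {f +ᴸ (-ᴸ f)} {[]} (+ᴸ-comm (-ᴸ f) f) (-ᴸ-inverseʳ f))
                      , -ᴸ-inverseʳ
            ; ⁻¹-cong = λ {f} {g} → -ᴸ-cong f g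
            }
          ; comm = +ᴸ-comm
          }
        ; *-cong     = λ {f} {f′} {g} {g′} → *ᴸ-cong f f′ g g′
        ; *-assoc    = *ᴸ-assoc
        ; *-identity = *ᴸ-identityˡ
                     , λ f → transᴸ {f *ᴸ 1ᴸ} {1ᴸ *ᴸ f} {f} (*ᴸ-comm f 1ᴸ) (*ᴸ-identityˡ f)
        ; distrib    = (λ h f g → transᴸ {h *ᴸ (f +ᴸ g)} {(f +ᴸ g) *ᴸ h} {(h *ᴸ f) +ᴸ (h *ᴸ g)}
                          (*ᴸ-comm h (f +ᴸ g))
                          (transᴸ {(f +ᴸ g) *ᴸ h} {(f *ᴸ h) +ᴸ (g *ᴸ h)} {(h *ᴸ f) +ᴸ (h *ᴸ g)}
                            (*ᴸ-distribʳ h f g)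
                            (+ᴸ-cong (f *ᴸ h) (h *ᴸ f) (g *ᴸ h) (h *ᴸ g) (*ᴸ-comm f h) (*ᴸ-comm g h))))
                     , *ᴸ-distribʳ
        }
      ; *-comm = *ᴸ-comm
      }

  laurentCommutativeRing : ℕ → CommutativeRing c ℓ
  laurentCommutativeRing r = record { isCommutativeRing = laurent-isCommutativeRing {r} }

  -- Monomial substitutions as ring homomorphisms.

  module _ {r s : ℕ} (ψ : Vec ℤ r → Carrier) (θ : Vec ℤ r → Vec ℤ s)
           (ψ-1 : ψ 0ᵥ ≈ 1#) (ψ-* : ∀ d e → ψ (d ⊕ e) ≈ ψ d * ψ e)
           (θ-0 : θ 0ᵥ ≡ 0ᵥ) (θ-+ : ∀ d e → θ (d ⊕ e) ≡ θ d ⊕ θ e) where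
    private
      module R = L r
      module S = L s
      ⟦_⟧ : Laurent r → Laurent s
      ⟦_⟧ = List.map (λ (a , e) → a * ψ e , θ e)
      -- The transpose of `⟦_⟧` for the pairing: by `⟪⟫-map`, testing `⟦ f ⟧` on `φ` amounts to
      -- testing `f` on `pull φ`.
      pull : (Vec ℤ s → Carrier) → Vec ℤ r → Carrier
      pull φ e = ψ e * φ (θ e)

    substitution-cong : ∀ f g → f ≈ᴸ g → ⟦ f ⟧ ≈ᴸ ⟦ g ⟧
    substitution-cong f g f≈g = ≋⇒≈ᴸ {f = ⟦ f ⟧} {⟦ g ⟧} λ φ →
      trans (⟪⟫-map ψ θ f φ) (trans (≈ᴸ⇒≋ {f = f} {g} f≈g (pull φ)) (sym (⟪⟫-map ψ θ g φ)))

    substitution-+ : ∀ f g → ⟦ f R.+ g ⟧ ≈ᴸ ⟦ f ⟧ S.+ ⟦ g ⟧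
    substitution-+ f g e = reflexive (≡.cong (λ f → coeff f e) (List.map-++ _ f g))

    substitution-neg : ∀ f → ⟦ R.- f ⟧ ≈ᴸ S.- ⟦ f ⟧
    substitution-neg f = ≋⇒≈ᴸ {f = ⟦ R.- f ⟧} {S.- ⟦ f ⟧} λ φ → begin
      ⟪ ⟦ R.- f ⟧ , φ ⟫      ≈⟨ ⟪⟫-map ψ θ (R.- f) φ ⟩
      ⟪ R.- f , pull φ ⟫     ≈⟨ ⟪⟫-neg f (pull φ) ⟩
      - ⟪ f , pull φ ⟫       ≈⟨ -‿cong (⟪⟫-map ψ θ f φ) ⟨
      - ⟪ ⟦ f ⟧ , φ ⟫        ≈⟨ ⟪⟫-neg ⟦ f ⟧ φ ⟨
      ⟪ S.- ⟦ f ⟧ , φ ⟫      ∎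

    substitution-1 : ⟦ R.1# ⟧ ≈ᴸ S.1#
    substitution-1 = ≋⇒≈ᴸ {f = ⟦ R.1# ⟧} {S.1#} λ φ →
      +-congʳ (trans (*-congʳ (trans (*-identityˡ _) ψ-1)) (*-congˡ (reflexive (≡.cong φ θ-0))))

    substitution-* : ∀ f g → ⟦ f R.* g ⟧ ≈ᴸ ⟦ f ⟧ S.* ⟦ g ⟧
    substitution-* f g = ≋⇒≈ᴸ {f = ⟦ f R.* g ⟧} {⟦ f ⟧ S.* ⟦ g ⟧} λ φ → begin
      ⟪ ⟦ f R.* g ⟧ , φ ⟫
        ≈⟨ ⟪⟫-map ψ θ (f R.* g) φ ⟩
      ⟪ f R.* g , pull φ ⟫
        ≈⟨ ⟪⟫-* f g (pull φ) ⟩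
      ⟪ f , (λ d → ⟪ g , (λ e → ψ (d ⊕ e) * φ (θ (d ⊕ e))) ⟫) ⟫
        ≈⟨ ⟪⟫-congʳ f (λ d → trans (⟪⟫-congʳ g (λ e → trans
             (*-cong (ψ-* d e) (reflexive (≡.cong φ (θ-+ d e)))) (*-assoc _ _ _)))
             (⟪⟫-*ʳ g (ψ d) (λ e → ψ e * φ (θ d ⊕ θ e)))) ⟩
      ⟪ f , (λ d → ψ d * ⟪ g , (λ e → ψ e * φ (θ d ⊕ θ e)) ⟫) ⟫
        ≈⟨ ⟪⟫-congʳ f (λ d → *-congˡ (⟪⟫-map ψ θ g (λ e → φ (θ d ⊕ e)))) ⟨
      ⟪ f , (λ d → ψ d * ⟪ ⟦ g ⟧ , (λ e → φ (θ d ⊕ e)) ⟫) ⟫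
        ≈⟨ ⟪⟫-map ψ θ f (λ d → ⟪ ⟦ g ⟧ , (λ e → φ (d ⊕ e)) ⟫) ⟨
      ⟪ ⟦ f ⟧ , (λ d → ⟪ ⟦ g ⟧ , (λ e → φ (d ⊕ e)) ⟫) ⟫
        ≈⟨ ⟪⟫-* ⟦ f ⟧ ⟦ g ⟧ φ ⟨
      ⟪ ⟦ f ⟧ S.* ⟦ g ⟧ , φ ⟫ ∎

    substitution-isRingHomomorphism :
      RingMorphisms.IsRingHomomorphism (laurentRing r) (laurentRing s) ⟦_⟧
    substitution-isRingHomomorphism = record
      { isSemiringHomomorphism = record
        { isNearSemiringHomomorphism = record
          { +-isMonoidHomomorphism = record
            { isMagmaHomomorphism = record
              { isRelHomomorphism = record { cong = λ {f} {g} → substitution-cong f g }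
              ; homo              = substitution-+
              }
            ; ε-homo = λ e → refl
            }
          ; *-homo = substitution-*
          }
        ; 1#-homo = substitution-1
        }
      ; -‿homo = substitution-neg
      }

-- Regular differences of monomials.

-- A hit would give |p - q| = n |w|, which is at least n.
progression-escapes : ∀ q w p → w ≢ 0ℤ → ∀ n → ℤ.∣ p ℤ.- q ∣ ℕ.< n → q ℤ.+ + n ℤ.* w ≢ p
progression-escapes q w p w≢0 n far hit = ℕ.<-irrefl ≡.refl $ begin-strict
  ℤ.∣ p ℤ.- q ∣                       <⟨ far ⟩
  n                                   ≤⟨ ℕ.m≤m*n n ℤ.∣ w ∣ {{ℤ.≢-nonZero w≢0}} ⟩
  n ℕ.* ℤ.∣ w ∣                       ≡⟨ ℤ.abs-* (+ n) w ⟨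
  ℤ.∣ + n ℤ.* w ∣                     ≡⟨ ≡.cong ℤ.∣_∣ (solve 2 (λ q m → q :+ m :- q := m) ≡.refl q (+ n ℤ.* w)) ⟨
  ℤ.∣ q ℤ.+ + n ℤ.* w ℤ.- q ∣         ≡⟨ ≡.cong (λ u → ℤ.∣ u ℤ.- q ∣) hit ⟩
  ℤ.∣ p ℤ.- q ∣                       ∎
  where
  open ℕ.≤-Reasoning
  open ℤSolver

module MonomialSeparation {c ℓ} (K : CommutativeRing c ℓ) where
  open CommutativeRing K hiding (zero)
  open LaurentPolynomials K
  open LaurentProperties K
  open DeterminantProperties K using (Separated)
  open import Algebra.Properties.Semiring.Exp semiring using (_^_)
  open import Relation.Binary.Reasoning.Setoid setoid

  module _ {r : ℕ} where
    open L r using () renaming (_*_ to _*ᴸ_)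
    open DeterminantProperties (laurentCommutativeRing r) using () renaming (Separated to Separatedᴸ)

    -- The effect on exponents of multiplying by zᵉ / zᵈ.
    shift : Vec ℤ r → Vec ℤ r → Vec ℤ r → Vec ℤ r
    shift d e q = (q ⊕ e) ⊕ Vec.map ℤ.-_ d

    shift-self : ∀ d q → shift d d q ≡ q
    shift-self d q = ≡.trans (⊕-assoc q d _)
      (≡.trans (≡.cong (q ⊕_) (Vec.zipWith-inverseʳ ℤ.+-inverseʳ d)) (Vec.zipWith-identityʳ ℤ.+-identityʳ q))

    ⟪⟫-*monomial : ∀ (h : Laurent r) a d φ →
      ⟪ h *ᴸ List.[ a , d ] , φ ⟫ ≈ a * ⟪ h , (λ q → φ (q ⊕ d)) ⟫
    ⟪⟫-*monomial h a d φ = trans (⟪⟫-* h List.[ a , d ] φ)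
      (trans (⟪⟫-congʳ h (λ q → +-identityʳ _)) (⟪⟫-*ʳ h a (λ q → φ (q ⊕ d))))

    -- The hypothesis is tested on `φ` translated by `-d`. This undoes the factor zᵈ on the left and
    -- leaves the shift by `e - d` on the right.
    balance : ∀ (h : Laurent r) {a b d e} → h *ᴸ List.[ a , d ] ≈ᴸ h *ᴸ List.[ b , e ] → ∀ φ →
      a * ⟪ h , φ ⟫ ≈ b * ⟪ h , (λ q → φ (shift d e q)) ⟫
    balance h {a} {b} {d} {e} eq φ = begin
      a * ⟪ h , φ ⟫
        ≈⟨ *-congˡ (⟪⟫-congʳ h λ q → reflexive (≡.cong φ (shift-self d q))) ⟨
      a * ⟪ h , (λ q → φ (shift d d q)) ⟫
        ≈⟨ ⟪⟫-*monomial h a d φ′ ⟨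
      ⟪ h *ᴸ List.[ a , d ] , φ′ ⟫
        ≈⟨ ≈ᴸ⇒≋ {f = h *ᴸ List.[ a , d ]} {h *ᴸ List.[ b , e ]} eq φ′ ⟩
      ⟪ h *ᴸ List.[ b , e ] , φ′ ⟫
        ≈⟨ ⟪⟫-*monomial h b e φ′ ⟩
      b * ⟪ h , (λ q → φ (shift d e q)) ⟫ ∎
      where
      φ′ : Vec ℤ r → Carrier
      φ′ q = φ (q ⊕ Vec.map ℤ.-_ d)

    separated-coefficients : ∀ {a b} d → Separated a b → Separatedᴸ List.[ a , d ] List.[ b , d ]
    separated-coefficients {a} {b} d sep h eq = ≋⇒≈ᴸ {f = h} {[]} λ φ → sep ⟪ h , φ ⟫ $ begin
      ⟪ h , φ ⟫ * a                          ≈⟨ *-comm _ _ ⟩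
      a * ⟪ h , φ ⟫                          ≈⟨ balance h eq φ ⟩
      b * ⟪ h , (λ q → φ (shift d d q)) ⟫    ≈⟨ *-congˡ (⟪⟫-congʳ h λ q → reflexive (≡.cong φ (shift-self d q))) ⟩
      b * ⟪ h , φ ⟫                          ≈⟨ *-comm _ _ ⟩
      ⟪ h , φ ⟫ * b                          ∎

    module _ {d e : Vec ℤ r} {k : Fin r} (dₖ≢eₖ : Vec.lookup d k ≢ Vec.lookup e k) where
      private
        τ : Vec ℤ r → Vec ℤ r
        τ = shift d e
        w : ℤ
        w = Vec.lookup e k ℤ.- Vec.lookup d k

      lookup-shift : ∀ q → Vec.lookup (τ q) k ≡ Vec.lookup q k ℤ.+ w
      lookup-shift q =
        ≡.trans (Vec.lookup-zipWith ℤ._+_ k (q ⊕ e) _)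
        (≡.trans (≡.cong₂ ℤ._+_ (Vec.lookup-zipWith ℤ._+_ k q e) (Vec.lookup-map k ℤ.-_ d))
                 (ℤ.+-assoc (Vec.lookup q k) _ _))

      lookup-iterate-shift : ∀ n q → Vec.lookup (iterate τ q n) k ≡ Vec.lookup q k ℤ.+ + n ℤ.* w
      lookup-iterate-shift zero    q = ≡.sym (ℤ.+-identityʳ _)
      lookup-iterate-shift (suc n) q =
        ≡.trans (lookup-iterate-shift n (τ q))
        (≡.trans (≡.cong (ℤ._+ + n ℤ.* w) (lookup-shift q))
        (≡.trans (ℤ.+-assoc (Vec.lookup q k) w (+ n ℤ.* w))
                 (≡.cong (λ u → Vec.lookup q k ℤ.+ u) (≡.sym (ℤ.suc-* (+ n) w)))))

      -- Coordinate `k` moves by the nonzero step `w`, so a term of exponent `q` cannot meet `p`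
      -- once the number of steps exceeds the distance between their coordinates `k`. The maximum of
      -- these bounds over the finitely many terms serves for all of `h`.
      support-escapes : ∀ (h : Laurent r) p →
        ∃[ N ] ∀ n → N ℕ.≤ n → ⟪ h , (λ q → indicator p (iterate τ q n)) ⟫ ≈ 0#
      support-escapes []            p = 0 , λ _ _ → refl
      support-escapes ((a , q) ∷ h) p =
        let N , escapes = support-escapes h p
            M = suc ℤ.∣ Vec.lookup p k ℤ.- Vec.lookup q k ∣ in
        M ℕ.⊔ N , λ n M⊔N≤n → begin
          a * indicator p (iterate τ q n) + _
            ≈⟨ +-cong (*-congˡ (missed n (ℕ.m⊔n≤o⇒m≤o M N M⊔N≤n))) (escapes n (ℕ.m⊔n≤o⇒n≤o M N M⊔N≤n)) ⟩
          a * 0# + 0#  ≈⟨ trans (+-identityʳ _) (zeroʳ a) ⟩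
          0#           ∎
        where
        missed : ∀ n → ℤ.∣ Vec.lookup p k ℤ.- Vec.lookup q k ∣ ℕ.< n →
                 indicator p (iterate τ q n) ≈ 0#
        missed n far with Vec.≡-dec ℤ._≟_ (iterate τ q n) p
        ... | no _ = refl
        ... | yes hit = contradiction
          (≡.trans (≡.sym (lookup-iterate-shift n q)) (≡.cong (λ v → Vec.lookup v k) hit))
          (progression-escapes (Vec.lookup q k) w (Vec.lookup p k)
            (λ w≡0 → dₖ≢eₖ (≡.sym (ℤ.i-j≡0⇒i≡j _ _ w≡0))) n far)

      -- h (a zᵈ) ≈ h (b zᵉ) says that the coefficients of h along the direction e - d form
      -- a geometric progression, which must leave the finite support of h.
      separated-exponents : ∀ {a b a⁻¹} → a⁻¹ * a ≈ 1# → Separatedᴸ List.[ a , d ] List.[ b , e ]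
      separated-exponents {a} {b} {a⁻¹} a⁻¹a≈1 h eq p =
        let N , escapes = support-escapes h p in begin
        coeff h p
          ≈⟨ coeff≈⟪indicator⟫ h p ⟩
        ⟪ h , indicator p ⟫
          ≈⟨ transport N (indicator p) ⟩
        (a⁻¹ * b) ^ N * ⟪ h , (λ q → indicator p (iterate τ q N)) ⟫
          ≈⟨ *-congˡ (escapes N ℕ.≤-refl) ⟩
        (a⁻¹ * b) ^ N * 0#
          ≈⟨ zeroʳ _ ⟩
        0# ∎
        where
        step : ∀ φ → ⟪ h , φ ⟫ ≈ (a⁻¹ * b) * ⟪ h , (λ q → φ (τ q)) ⟫
        step φ = begin
          ⟪ h , φ ⟫                                ≈⟨ *-identityˡ _ ⟨
          1# * ⟪ h , φ ⟫                           ≈⟨ *-congʳ a⁻¹a≈1 ⟨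
          a⁻¹ * a * ⟪ h , φ ⟫                      ≈⟨ *-assoc _ _ _ ⟩
          a⁻¹ * (a * ⟪ h , φ ⟫)                    ≈⟨ *-congˡ (balance h eq φ) ⟩
          a⁻¹ * (b * ⟪ h , (λ q → φ (τ q)) ⟫)      ≈⟨ *-assoc _ _ _ ⟨
          a⁻¹ * b * ⟪ h , (λ q → φ (τ q)) ⟫        ∎
        transport : ∀ n φ → ⟪ h , φ ⟫ ≈ (a⁻¹ * b) ^ n * ⟪ h , (λ q → φ (iterate τ q n)) ⟫
        transport zero    φ = sym (*-identityˡ _)
        transport (suc n) φ = begin
          ⟪ h , φ ⟫
            ≈⟨ transport n φ ⟩
          (a⁻¹ * b) ^ n * ⟪ h , (λ q → φ (iterate τ q n)) ⟫
            ≈⟨ *-congˡ (step (λ q → φ (iterate τ q n))) ⟩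
          (a⁻¹ * b) ^ n * ((a⁻¹ * b) * ⟪ h , (λ q → φ (iterate τ (τ q) n)) ⟫)
            ≈⟨ *-assoc _ _ _ ⟨
          (a⁻¹ * b) ^ n * (a⁻¹ * b) * ⟪ h , (λ q → φ (iterate τ (τ q) n)) ⟫
            ≈⟨ *-congʳ (*-comm _ _) ⟩
          (a⁻¹ * b) ^ suc n * ⟪ h , (λ q → φ (iterate τ (τ q) n)) ⟫ ∎

-- Roots of unity and integer powers of units.

module RootsOfUnity {c ℓ₁ ℓ₂} (ℂ : ExponentialField c ℓ₁ ℓ₂) where
  open ExponentialField ℂ
  private module ℂ = CommutativeRing commutativeRing
  open import Algebra.Properties.Semiring.Exp ℂ.semiring using (^-homo-*)
  open import Algebra.Properties.Semiring.Mult ℂ.semiring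
    using (×-congʳ; ×-congˡ; ×-homo-+; ×-assocˡ; ×-assoc-*)
  open import Algebra.Properties.CommutativeMonoid.Mult ℂ.+-commutativeMonoid using (×-distrib-+)
  open import Algebra.Properties.Ring ℂ.ring using (-0#≈0#; +-cancelˡ)
  open DeterminantProperties commutativeRing using (Separated)
  open import Relation.Binary.Reasoning.Setoid ℂ.setoid

  #0⇒unit : ∀ {x} → x # 0# → ∃[ y ] y * x ≈ 1#
  #0⇒unit {x} x#0 = let y , y*[x-0]≈1 , _ = #⇒invertible x#0 in
    y , trans (*-congˡ (sym (trans (+-congˡ -0#≈0#) (+-identityʳ x)))) y*[x-0]≈1

  *-cancelˡ-unit : ∀ {x x⁻¹} → x⁻¹ * x ≈ 1# → ∀ {y z} → x * y ≈ x * z → y ≈ z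
  *-cancelˡ-unit {x} {x⁻¹} x⁻¹x≈1 {y} {z} xy≈xz = begin
    y              ≈⟨ *-identityˡ y ⟨
    1# * y         ≈⟨ *-congʳ x⁻¹x≈1 ⟨
    x⁻¹ * x * y    ≈⟨ *-assoc _ _ _ ⟩
    x⁻¹ * (x * y)  ≈⟨ *-congˡ xy≈xz ⟩
    x⁻¹ * (x * z)  ≈⟨ *-assoc _ _ _ ⟨
    x⁻¹ * x * z    ≈⟨ *-congʳ x⁻¹x≈1 ⟩
    1# * z         ≈⟨ *-identityˡ z ⟩
    z              ∎

  -- The conclusion is an equality, hence stable by tightness: it suffices to refute h # 0#.
  ≉⇒separated : ∀ {x y} → ¬ x ≈ y → Separated x y
  ≉⇒separated x≉y h hx≈hy = proj₁ (tight h 0#) λ h#0 →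
    x≉y (*-cancelˡ-unit (proj₂ (#0⇒unit h#0)) hx≈hy)

  ·-as-* : ∀ n x → n · x ≈ n · 1# * x
  ·-as-* n x = sym (trans (×-assoc-* n 1# x) (×-congʳ n (*-identityˡ x)))

  ·-cancelˡ : ∀ n .{{_ : NonZero n}} {x y} → n · x ≈ n · y → x ≈ y
  ·-cancelˡ n {x} {y} nx≈ny = *-cancelˡ-unit (proj₂ (#0⇒unit (characteristic-0 n)))
    (trans (sym (·-as-* n x)) (trans nx≈ny (·-as-* n y)))

  ·2πi≈0⇒≡0 : ∀ n → n · 2πi ≈ 0# → n ≡ 0
  ·2πi≈0⇒≡0 zero        _      = ≡.refl
  ·2πi≈0⇒≡0 n@(suc _) n2πi≈0 = contradiction (characteristic-0 n) λ n#0 →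
    #-irrefl (*-cancelˡ-unit (proj₂ (#0⇒unit 2πi#0)) (begin
      2πi * (n · 1#)  ≈⟨ *-comm _ _ ⟩
      n · 1# * 2πi    ≈⟨ ·-as-* n 2πi ⟨
      n · 2πi         ≈⟨ n2πi≈0 ⟩
      0#              ≈⟨ ℂ.zeroʳ 2πi ⟨
      2πi * 0#        ∎)) n#0

  ·2πi-injective-≤ : ∀ {m n} → m ℕ.≤ n → m · 2πi ≈ n · 2πi → m ≡ n
  ·2πi-injective-≤ {m} {n} m≤n m2πi≈n2πi =
    ≡.trans (≡.sym (ℕ.+-identityʳ m))
      (≡.trans (≡.cong (m ℕ.+_) (≡.sym n∸m≡0)) (ℕ.m+[n∸m]≡n m≤n))
    where
    n∸m≡0 : n ℕ.∸ m ≡ 0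
    n∸m≡0 = ·2πi≈0⇒≡0 (n ℕ.∸ m) $ +-cancelˡ (m · 2πi) _ _ $ begin
      m · 2πi + (n ℕ.∸ m) · 2πi   ≈⟨ ×-homo-+ 2πi m (n ℕ.∸ m) ⟨
      (m ℕ.+ (n ℕ.∸ m)) · 2πi     ≈⟨ ×-congˡ (ℕ.m+[n∸m]≡n m≤n) ⟩
      n · 2πi                     ≈⟨ m2πi≈n2πi ⟨
      m · 2πi                     ≈⟨ +-identityʳ _ ⟨
      m · 2πi + 0#                ∎

  ·2πi-injective : ∀ {m n} → m · 2πi ≈ n · 2πi → m ≡ n
  ·2πi-injective {m} {n} eq with ℕ.≤-total m n
  ... | inj₁ m≤n = ·2πi-injective-≤ m≤n eq
  ... | inj₂ n≤m = ≡.sym (·2πi-injective-≤ n≤m (sym eq))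

  exp-· : ∀ n x → exp (n · x) ≈ exp x ^ n
  exp-· zero    x = exp-0
  exp-· (suc n) x = trans (exp-+ x (n · x)) (*-congˡ (exp-· n x))

  t·2πi/t : ∀ t .{{_ : NonZero t}} → t · (2πi/ t) ≈ 2πi
  t·2πi/t t = begin
    t · (2πi/ t)                ≈⟨ ·-as-* t (2πi/ t) ⟩
    t · 1# * (y * 2πi)          ≈⟨ *-assoc _ _ _ ⟨
    t · 1# * y * 2πi            ≈⟨ *-congʳ (*-comm _ _) ⟩
    y * (t · 1#) * 2πi          ≈⟨ *-congʳ (proj₂ (#0⇒unit (characteristic-0 t))) ⟩
    1# * 2πi                    ≈⟨ *-identityˡ _ ⟩
    2πi                         ∎
    where
    y : Carrier
    -- By unfolding, this is the very inverse of `t · 1#` that occurs in `2πi/ t`.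
    y = proj₁ (#0⇒unit (characteristic-0 t))

  ζ^t≈1 : ∀ t .{{_ : NonZero t}} → ζ t ^ t ≈ 1#
  ζ^t≈1 t = trans (sym (exp-· t (2πi/ t))) (trans (exp-cong (t·2πi/t t)) exp-2πi)

  -- `exp-kernel` makes k · 2πi/t equal to n · 2πi or to its negative. Multiplying by t and
  -- cancelling 2πi gives k = t n in the first case and k + t n = 0 in the second, where k must be
  -- 0.
  ζ^k≈1⇒t∣k : ∀ t .{{_ : NonZero t}} k → ζ t ^ k ≈ 1# → t ∣ k
  ζ^k≈1⇒t∣k t k ζ^k≈1 with exp-kernel (trans (exp-· k (2πi/ t)) ζ^k≈1)
  ... | n , inj₁ kw≈n2πi = divides n (≡.trans (·2πi-injective (begin
    k · 2πi           ≈⟨ k·2πi ⟩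
    t · (k · (2πi/ t)) ≈⟨ ×-congʳ t kw≈n2πi ⟩
    t · (n · 2πi)     ≈⟨ ×-assocˡ 2πi t n ⟩
    (t ℕ.* n) · 2πi   ∎)) (ℕ.*-comm t n))
    where
    k·2πi : k · 2πi ≈ t · (k · (2πi/ t))
    k·2πi = begin
      k · 2πi                 ≈⟨ ×-congʳ k (t·2πi/t t) ⟨
      k · (t · (2πi/ t))      ≈⟨ ×-assocˡ _ k t ⟩
      (k ℕ.* t) · (2πi/ t)    ≈⟨ ×-congˡ (ℕ.*-comm k t) ⟩
      (t ℕ.* k) · (2πi/ t)    ≈⟨ ×-assocˡ _ t k ⟨
      t · (k · (2πi/ t))      ∎
  ... | n , inj₂ kw≈-n2πi = ≡.subst (t ∣_) (≡.sym k≡0) (t ℕ.∣0)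
    where
    k≡0 : k ≡ 0
    k≡0 = ℕ.m+n≡0⇒m≡0 k $ ·2πi≈0⇒≡0 (k ℕ.+ t ℕ.* n) $ begin
      (k ℕ.+ t ℕ.* n) · 2πi              ≈⟨ ×-homo-+ 2πi k (t ℕ.* n) ⟩
      k · 2πi + (t ℕ.* n) · 2πi          ≈⟨ +-cong (×-congʳ k (t·2πi/t t)) (×-assocˡ 2πi t n) ⟨
      k · (t · (2πi/ t)) + t · (n · 2πi) ≈⟨ +-congʳ (trans (×-assocˡ _ k t)
                                              (trans (×-congˡ (ℕ.*-comm k t)) (sym (×-assocˡ _ t k)))) ⟩
      t · (k · (2πi/ t)) + t · (n · 2πi) ≈⟨ ×-distrib-+ _ _ t ⟨
      t · (k · (2πi/ t) + n · 2πi)       ≈⟨ ×-congʳ t (trans (+-congʳ kw≈-n2πi) (-‿inverseˡ _)) ⟩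
      t · 0#                             ≈⟨ trans (·-as-* t 0#) (ℂ.zeroʳ _) ⟩
      0#                                 ∎

  ζ^-isUnit : ∀ t .{{_ : NonZero t}} n → proj₁ (^-isUnit (ζ-isUnit t) n) * ζ t ^ n ≈ 1#
  ζ^-isUnit t n = proj₁ (proj₂ (^-isUnit (ζ-isUnit t) n))

  ζ^-injective-< : ∀ t .{{_ : NonZero t}} {i j} → i ℕ.< j → j ℕ.< t → ¬ ζ t ^ i ≈ ζ t ^ j
  ζ^-injective-< t {i} {j} i<j j<t ζⁱ≈ζʲ = ℕ.<⇒≱ j<t $ ℕ.≤-trans
    (ℕ.∣⇒≤ {{ℕ.>-nonZero (ℕ.m<n⇒0<n∸m i<j)}} (ζ^k≈1⇒t∣k t (j ℕ.∸ i) ζ^[j-i]≈1)) (ℕ.m∸n≤m j i)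
    where
    ζ^[j-i]≈1 : ζ t ^ (j ℕ.∸ i) ≈ 1#
    ζ^[j-i]≈1 = *-cancelˡ-unit (ζ^-isUnit t i) $ begin
      ζ t ^ i * ζ t ^ (j ℕ.∸ i)  ≈⟨ ^-homo-* (ζ t) i (j ℕ.∸ i) ⟨
      ζ t ^ (i ℕ.+ (j ℕ.∸ i))    ≈⟨ reflexive (≡.cong (ζ t ^_) (ℕ.m+[n∸m]≡n (ℕ.<⇒≤ i<j))) ⟩
      ζ t ^ j                    ≈⟨ ζⁱ≈ζʲ ⟨
      ζ t ^ i                    ≈⟨ *-identityʳ _ ⟨
      ζ t ^ i * 1#               ∎

  ζ^-injective : ∀ t .{{_ : NonZero t}} {i j : Fin t} → i ≢ j → ¬ ζ t ^ toℕ i ≈ ζ t ^ toℕ j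
  ζ^-injective t {i} {j} i≢j with ℕ.<-cmp (toℕ i) (toℕ j)
  ... | tri< i<j _ _ = ζ^-injective-< t i<j (Fin.toℕ<n j)
  ... | tri≈ _ i≡j _ = contradiction (Fin.toℕ-injective i≡j) i≢j
  ... | tri> _ _ j<i = ζ^-injective-< t j<i (Fin.toℕ<n i) ∘ sym

  -- The equation holds already before `exp` is applied, since `t` times either argument is 2πi.
  -- With `t = 2` it identifies the middle power of ξ for an even order as `ζ 2`.
  ζ-tower : ∀ s t {q} .{{_ : NonZero t}} .{{_ : NonZero q}} → q ≡ s ℕ.* t → ζ q ^ s ≈ ζ t
  ζ-tower s t {q} q≡st = trans (sym (exp-· s (2πi/ q))) $ exp-cong $ ·-cancelˡ t $ begin
    t · (s · (2πi/ q))    ≈⟨ ×-assocˡ _ t s ⟩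
    (t ℕ.* s) · (2πi/ q)  ≈⟨ ×-congˡ (≡.trans (ℕ.*-comm t s) (≡.sym q≡st)) ⟩
    q · (2πi/ q)          ≈⟨ t·2πi/t q ⟩
    2πi                   ≈⟨ t·2πi/t t ⟨
    t · (2πi/ t)          ∎

  module _ {x : Carrier} (u : IsUnit x) where
    private
      x⁻¹ : Carrier
      x⁻¹ = proj₁ u

    -- Integers of opposite sign are added by way of `_⊖_`, so this settles the mixed cases of
    -- `unit^-+`.
    unit^-⊖ : ∀ m n → unit^ x u (m ℤ.⊖ n) ≈ x ^ m * x⁻¹ ^ n
    unit^-⊖ m       zero    = sym (*-identityʳ _)
    unit^-⊖ zero    (suc n) = sym (*-identityˡ _)
    unit^-⊖ (suc m) (suc n) = begin
      unit^ x u (suc m ℤ.⊖ suc n)      ≡⟨ ≡.cong (unit^ x u) (ℤ.[1+m]⊖[1+n]≡m⊖n m n) ⟩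
      unit^ x u (m ℤ.⊖ n)              ≈⟨ unit^-⊖ m n ⟩
      x ^ m * x⁻¹ ^ n                  ≈⟨ *-identityˡ _ ⟨
      1# * (x ^ m * x⁻¹ ^ n)           ≈⟨ *-congʳ (proj₂ (proj₂ u)) ⟨
      x * x⁻¹ * (x ^ m * x⁻¹ ^ n)      ≈⟨ interchange x x⁻¹ _ _ ⟩
      x ^ suc m * x⁻¹ ^ suc n          ∎
      where open import Algebra.Properties.CommutativeSemigroup ℂ.*-commutativeSemigroup using (interchange)

    unit^-+ : ∀ i j → unit^ x u (i ℤ.+ j) ≈ unit^ x u i * unit^ x u j
    unit^-+ (+ m)    (+ n)    = ^-homo-* x m n
    unit^-+ (+ m)    -[1+ n ] = unit^-⊖ m (suc n)
    unit^-+ -[1+ m ] (+ n)    = trans (unit^-⊖ n (suc m)) (*-comm _ _)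
    unit^-+ -[1+ m ] -[1+ n ] = begin
      x⁻¹ ^ suc (suc (m ℕ.+ n))    ≡⟨ ≡.cong (λ k → x⁻¹ ^ suc k) (ℕ.+-suc m n) ⟨
      x⁻¹ ^ (suc m ℕ.+ suc n)      ≈⟨ ^-homo-* x⁻¹ (suc m) (suc n) ⟩
      x⁻¹ ^ suc m * x⁻¹ ^ suc n    ∎

-- Lists of points and their rearrangement.

module _ {a} {A : Set a} where

  pairs : ∀ r → (Fin r → A) → (Fin r → A) → List A
  pairs zero    u v = []
  pairs (suc r) u v = u zero ∷ v zero ∷ pairs r (u ∘ suc) (v ∘ suc)

  pairs-+ : ∀ m r (u v : Fin (m ℕ.+ r) → A) →
            pairs (m ℕ.+ r) u v ≡
            pairs m (u ∘ (_↑ˡ r)) (v ∘ (_↑ˡ r)) ++ pairs r (u ∘ (m ↑ʳ_)) (v ∘ (m ↑ʳ_))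
  pairs-+ zero    r u v = ≡.refl
  pairs-+ (suc m) r u v = ≡.cong (λ l → u zero ∷ v zero ∷ l) (pairs-+ m r (u ∘ suc) (v ∘ suc))

  tabulate-splitAt : ∀ t q (h : Fin t ⊎ Fin q → A) →
                     tabulate (h ∘ splitAt t) ≡ tabulate (h ∘ inj₁) ++ tabulate (h ∘ inj₂)
  tabulate-splitAt zero    q h = ≡.refl
  tabulate-splitAt (suc t) q h = ≡.cong (h (inj₁ zero) ∷_) (tabulate-splitAt t q (h ∘ Sum.map₁ suc))

  tabulate-remQuot : ∀ r (h : Fin r × Fin 2 → A) →
                     tabulate (h ∘ remQuot {r} 2) ≡
                     pairs r (λ k → h (k , zero)) (λ k → h (k , suc zero))
  tabulate-remQuot zero    h = ≡.refl
  tabulate-remQuot (suc r) h = ≡.cong (λ l → h (zero , zero) ∷ h (zero , suc zero) ∷ l)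
    (tabulate-remQuot r (λ (k , s) → h (suc k , s)))

  tabulate-+ : ∀ m n (E : ℕ → A) →
               tabulate {n = m ℕ.+ n} (E ∘ toℕ) ≡
               tabulate {n = m} (E ∘ toℕ) ++ tabulate {n = n} (λ k → E (m ℕ.+ toℕ k))
  tabulate-+ zero    n E = ≡.refl
  tabulate-+ (suc m) n E = ≡.cong (E 0 ∷_) (tabulate-+ m n (E ∘ suc))

  tabulate-∷ʳ : ∀ {n} (g : Fin (suc n) → A) → tabulate (g ∘ inject₁) ∷ʳ g (fromℕ n) ≡ tabulate g
  tabulate-∷ʳ {zero}  g = ≡.refl
  tabulate-∷ʳ {suc n} g = ≡.cong (g zero ∷_) (tabulate-∷ʳ (g ∘ suc))

  pairs-pointwise : ∀ {ℓ} {_∼_ : Rel A ℓ} r {u u′ v v′ : Fin r → A} →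
                    (∀ k → u k ∼ u′ k) → (∀ k → v k ∼ v′ k) →
                    Pointwise _∼_ (pairs r u v) (pairs r u′ v′)
  pairs-pointwise zero    p q = []
  pairs-pointwise (suc r) p q = p zero ∷ q zero ∷ pairs-pointwise r (p ∘ suc) (q ∘ suc)

-- The indices of the points: a power of ζ, or a variable together with the sign of its exponent.
Label : ℕ → ℕ → Set
Label t r = Fin t ⊎ (Fin r × Fin 2)

label : ∀ t r → Fin (t ℕ.+ r ℕ.* 2) → Label t r
label t r i = Sum.map₂ (remQuot {r} 2) (splitAt t i)

label-injective : ∀ t r {i j} → label t r i ≡ label t r j → i ≡ j
label-injective t r {i} {j} eq = ≡.trans (≡.sym (unlabel-label i)) (≡.trans (≡.cong unlabel eq) (unlabel-label j))
  where
  unlabel : Label t r → Fin (t ℕ.+ r ℕ.* 2)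
  unlabel (inj₁ k)       = k ↑ˡ (r ℕ.* 2)
  unlabel (inj₂ (k , s)) = t ↑ʳ combine k s
  unlabel-label : ∀ i → unlabel (label t r i) ≡ i
  unlabel-label i with splitAt t i in eq
  ... | inj₁ k = Fin.splitAt⁻¹-↑ˡ eq
  ... | inj₂ p = ≡.trans (≡.cong (t ↑ʳ_) (Fin.combine-remQuot {r} 2 p)) (Fin.splitAt⁻¹-↑ʳ eq)

tabulate-label : ∀ {a} {A : Set a} t r (h : Label t r → A) →
                 tabulate (h ∘ label t r) ≡
                 tabulate (h ∘ inj₁) ++ pairs r (λ k → h (inj₂ (k , zero))) (λ k → h (inj₂ (k , suc zero)))
tabulate-label t r h = ≡.trans (tabulate-splitAt t (r ℕ.* 2) (h ∘ Sum.map₂ (remQuot {r} 2)))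
  (≡.cong (tabulate (h ∘ inj₁) ++_) (tabulate-remQuot r (h ∘ inj₂)))

module TabulatePermutation {a ℓ} (S : Setoid a ℓ) where
  open Setoid S using () renaming (Carrier to A)
  open Permutation S
  open PermutationProperties S

  pairs-↭ : ∀ m (u v : Fin m → A) → pairs m u v ↭ tabulate u ++ tabulate v
  pairs-↭ zero    u v = ↭-refl
  pairs-↭ (suc m) u v = ↭-prep (u zero) (↭-trans (↭-prep (v zero) (pairs-↭ m (u ∘ suc) (v ∘ suc)))
    (↭-sym (↭-shift (tabulate (u ∘ suc)) (tabulate (v ∘ suc)))))

  tabulate-opposite : ∀ {n} (g : Fin n → A) → tabulate (g ∘ opposite) ↭ tabulate g
  tabulate-opposite {zero}  g = ↭-refl
  tabulate-opposite {suc n} g = ↭-trans (↭-prep (g (fromℕ n)) (tabulate-opposite (g ∘ inject₁)))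
    (↭-trans (∷↭∷ʳ (g (fromℕ n)) (tabulate (g ∘ inject₁))) (↭-reflexive (tabulate-∷ʳ g)))

  -- Exponents k and t - k are paired; the unpaired ones are 0 and the w middle ones.
  unfold-pairs : ∀ {t} m w (E : ℕ → A) → t ≡ suc (m ℕ.+ (w ℕ.+ m)) → ∀ Z →
    (E 0 ∷ tabulate {n = w} (λ k → E (suc (m ℕ.+ toℕ k)))) ++
      (pairs m (λ k → E (suc (toℕ k))) (λ k → E (suc (m ℕ.+ (w ℕ.+ toℕ (opposite k))))) ++ Z)
    ↭ tabulate {n = t} (E ∘ toℕ) ++ Z
  unfold-pairs m w E ≡.refl Z = ↭-prep (E 0) $ begin
    W ++ (pairs m P (Q ∘ opposite) ++ Z)
      ↭⟨ ++⁺ˡ W (++⁺ʳ Z (↭-trans (pairs-↭ m P (Q ∘ opposite)) (++⁺ˡ (tabulate P) (tabulate-opposite Q)))) ⟩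
    W ++ ((tabulate P ++ tabulate Q) ++ Z)
      ↭⟨ ++-assoc W (tabulate P ++ tabulate Q) Z ⟨
    (W ++ (tabulate P ++ tabulate Q)) ++ Z
      -- Moving the middle block between the lower exponents `P` and the upper exponents `Q` puts
      -- all of them in increasing order.
      ↭⟨ ++⁺ʳ Z (shifts W (tabulate P)) ⟩
    (tabulate P ++ (W ++ tabulate Q)) ++ Z
      ≡⟨ ≡.cong (λ l → (tabulate P ++ l) ++ Z) (tabulate-+ w m (λ k → E (suc (m ℕ.+ k)))) ⟨
    (tabulate P ++ tabulate {n = w ℕ.+ m} (λ k → E (suc (m ℕ.+ toℕ k)))) ++ Z
      ≡⟨ ≡.cong (_++ Z) (tabulate-+ m (w ℕ.+ m) (E ∘ suc)) ⟨
    tabulate {n = m ℕ.+ (w ℕ.+ m)} (E ∘ suc ∘ toℕ) ++ Z ∎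
    where
    open PermutationReasoning
    W : List A
    W = tabulate {n = w} (λ k → E (suc (m ℕ.+ toℕ k)))
    P Q : Fin m → A
    P k = E (suc (toℕ k))
    Q k = E (suc (m ℕ.+ (w ℕ.+ toℕ k)))

-- Specialisation of the first variables.

take-update-↑ˡ : ∀ {a} {A : Set a} {m} r (xs : Vec A (m ℕ.+ r)) (i : Fin m) x →
                 Vec.take m (xs [ i ↑ˡ r ]≔ x) ≡ Vec.take m xs [ i ]≔ x
take-update-↑ˡ r (y Vec.∷ xs) zero    x = ≡.refl
take-update-↑ˡ r (y Vec.∷ xs) (suc i) x = ≡.cong (y Vec.∷_) (take-update-↑ˡ r xs i x)

drop-update-↑ˡ : ∀ {a} {A : Set a} {m} r (xs : Vec A (m ℕ.+ r)) (i : Fin m) x →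
                 Vec.drop m (xs [ i ↑ˡ r ]≔ x) ≡ Vec.drop m xs
drop-update-↑ˡ r (y Vec.∷ xs) zero    x = ≡.refl
drop-update-↑ˡ r (y Vec.∷ xs) (suc i) x = drop-update-↑ˡ r xs i x

take-update-↑ʳ : ∀ {a} {A : Set a} m {r} (xs : Vec A (m ℕ.+ r)) (i : Fin r) x →
                 Vec.take m (xs [ m ↑ʳ i ]≔ x) ≡ Vec.take m xs
take-update-↑ʳ zero    xs           i x = ≡.refl
take-update-↑ʳ (suc m) (y Vec.∷ xs) i x = ≡.cong (y Vec.∷_) (take-update-↑ʳ m xs i x)

drop-update-↑ʳ : ∀ {a} {A : Set a} m {r} (xs : Vec A (m ℕ.+ r)) (i : Fin r) x →
                 Vec.drop m (xs [ m ↑ʳ i ]≔ x) ≡ Vec.drop m xs [ i ]≔ x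
drop-update-↑ʳ zero    xs           i x = ≡.refl
drop-update-↑ʳ (suc m) (y Vec.∷ xs) i x = drop-update-↑ʳ m xs i x

take-replicate : ∀ {a} {A : Set a} m {r} (x : A) →
                 Vec.take m (Vec.replicate (m ℕ.+ r) x) ≡ Vec.replicate m x
take-replicate zero    x = ≡.refl
take-replicate (suc m) x = ≡.cong (x Vec.∷_) (take-replicate m x)

drop-replicate : ∀ {a} {A : Set a} m {r} (x : A) →
                 Vec.drop m (Vec.replicate (m ℕ.+ r) x) ≡ Vec.replicate r x
drop-replicate zero    x = ≡.refl
drop-replicate (suc m) x = drop-replicate m x

module Specialisation {c ℓ₁ ℓ₂} (ℂ : ExponentialField c ℓ₁ ℓ₂) where
  open ExponentialField ℂ
  open Φ ℂ
  open RootsOfUnity ℂ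
  open LaurentProperties commutativeRing
  private module ℂ = CommutativeRing commutativeRing
  open import Algebra.Properties.CommutativeMonoid.Sum ℂ.*-commutativeMonoid
    using () renaming (∑-distrib-+ to product-*; sum-cong-≋ to product-cong; sum-replicate-zero to product-1)
  open import Relation.Binary.Reasoning.Setoid ℂ.setoid

  singleton-cong : ∀ {r a b} {d e : Vec ℤ r} → a ≈ b → d ≡ e → List.[ a , d ] ≈ᴸ List.[ b , e ]
  singleton-cong {a = a} {b} {d} a≈b ≡.refl = ≋⇒≈ᴸ {f = List.[ a , d ]} {List.[ b , d ]} λ φ →
    +-congʳ (*-congʳ a≈b)

  product≈1 : ∀ {n} (f : Fin n → Carrier) → (∀ k → f k ≈ 1#) → product f ≈ 1#
  product≈1 {n} f f≈1 = trans (product-cong {x = f} {λ _ → 1#} f≈1) (product-1 n)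

  product-single : ∀ {n} (f : Fin n → Carrier) i → (∀ {k} → k ≢ i → f k ≈ 1#) → product f ≈ f i
  product-single f zero    f≈1 = trans (*-congˡ (product≈1 (f ∘ suc) λ k → f≈1 λ ())) (*-identityʳ _)
  product-single f (suc i) f≈1 = trans (*-cong (f≈1 λ ())
    (product-single (f ∘ suc) i λ k≢i → f≈1 (k≢i ∘ Fin.suc-injective))) (*-identityˡ _)

  module _ {m r : ℕ} (y : Fin m → Carrier) (y-unit : ∀ k → IsUnit (y k)) where
    private
      0ᵥ : ∀ {n} → Vec ℤ n
      0ᵥ = Vec.replicate _ 0ℤ

    powers : Vec ℤ m → Carrier
    powers e = product (λ k → unit^ (y k) (y-unit k) (Vec.lookup e k))

    powers-0 : powers 0ᵥ ≈ 1#
    powers-0 = product≈1 (λ k → unit^ (y k) (y-unit k) (Vec.lookup 0ᵥ k)) λ k →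
      reflexive (≡.cong (unit^ (y k) (y-unit k)) (Vec.lookup-replicate k 0ℤ))

    powers-+ : ∀ d e → powers (d ⊕ e) ≈ powers d * powers e
    powers-+ d e = trans
      (product-cong {x = λ k → unit^ (y k) (y-unit k) (Vec.lookup (d ⊕ e) k)} {λ k → p d k * p e k} λ k →
        trans (reflexive (≡.cong (unit^ (y k) (y-unit k)) (Vec.lookup-zipWith ℤ._+_ k d e)))
              (unit^-+ (y-unit k) (Vec.lookup d k) (Vec.lookup e k)))
      (product-* (p d) (p e))
      where
      p : Vec ℤ m → Fin m → Carrier
      p d k = unit^ (y k) (y-unit k) (Vec.lookup d k)

    powers-update : ∀ i j → powers (0ᵥ [ i ]≔ j) ≈ unit^ (y i) (y-unit i) j
    powers-update i j = trans
      (product-single (λ k → unit^ (y k) (y-unit k) (Vec.lookup (0ᵥ [ i ]≔ j) k)) i λ {k} k≢i →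
        reflexive (≡.cong (unit^ (y k) (y-unit k))
          (≡.trans (Vec.lookup∘update′ k≢i 0ᵥ j) (Vec.lookup-replicate k 0ℤ))))
      (reflexive (≡.cong (unit^ (y i) (y-unit i)) (Vec.lookup∘update i 0ᵥ j)))

    specialise-isRingHomomorphism :
      RingMorphisms.IsRingHomomorphism (laurentRing (m ℕ.+ r)) (laurentRing r) (specialise {m} {r} y y-unit)
    specialise-isRingHomomorphism = substitution-isRingHomomorphism
      (λ e → powers (Vec.take m e)) (Vec.drop m)
      (trans (reflexive (≡.cong powers (take-replicate m {r} 0ℤ))) powers-0)
      (λ d e → trans (reflexive (≡.cong powers (Vec.take-zipWith ℤ._+_ d e)))
                     (powers-+ (Vec.take m d) (Vec.take m e)))
      (drop-replicate m 0ℤ)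
      (λ d e → Vec.drop-zipWith {m = m} ℤ._+_ d e)

    specialise-const : ∀ a → specialise {m} {r} y y-unit (const a) ≈ᴸ const a
    specialise-const a = singleton-cong
      (trans (*-congˡ (trans (reflexive (≡.cong powers (take-replicate m {r} 0ℤ))) powers-0)) (*-identityʳ a))
      (drop-replicate m 0ℤ)

    -- A general exponent `j` treats `var` (j = 1) and `var⁻¹` (j = -1) together.
    specialise-substituted : ∀ i j →
      specialise {m} {r} y y-unit List.[ 1# , 0ᵥ [ i ↑ˡ r ]≔ j ] ≈ᴸ const (unit^ (y i) (y-unit i) j)
    specialise-substituted i j = singleton-cong
      (begin
        1# * powers (Vec.take m (0ᵥ [ i ↑ˡ r ]≔ j))  ≈⟨ *-identityˡ _ ⟩
        powers (Vec.take m (0ᵥ [ i ↑ˡ r ]≔ j))       ≡⟨ ≡.cong powers (take-update-↑ˡ r 0ᵥ i j) ⟩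
        powers (Vec.take m {r} 0ᵥ [ i ]≔ j)          ≡⟨ ≡.cong (λ v → powers (v [ i ]≔ j)) (take-replicate m {r} 0ℤ) ⟩
        powers (0ᵥ [ i ]≔ j)                         ≈⟨ powers-update i j ⟩
        unit^ (y i) (y-unit i) j                     ∎)
      (≡.trans (drop-update-↑ˡ r 0ᵥ i j) (drop-replicate m 0ℤ))

    specialise-free : ∀ k j →
      specialise {m} {r} y y-unit List.[ 1# , 0ᵥ [ m ↑ʳ k ]≔ j ] ≈ᴸ List.[ 1# , 0ᵥ [ k ]≔ j ]
    specialise-free k j = singleton-cong
      (begin
        1# * powers (Vec.take m (0ᵥ [ m ↑ʳ k ]≔ j))  ≈⟨ *-identityˡ _ ⟩
        powers (Vec.take m (0ᵥ [ m ↑ʳ k ]≔ j))       ≡⟨ ≡.cong powers (take-update-↑ʳ m 0ᵥ k j) ⟩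
        powers (Vec.take m {r} 0ᵥ)                   ≡⟨ ≡.cong powers (take-replicate m {r} 0ℤ) ⟩
        powers 0ᵥ                                    ≈⟨ powers-0 ⟩
        1#                                           ∎)
      (≡.trans (drop-update-↑ʳ m 0ᵥ k j) (≡.cong (_[ k ]≔ j) (drop-replicate m 0ℤ)))

-- The points: separation and permutation.

module Points {c ℓ₁ ℓ₂} (ℂ : ExponentialField c ℓ₁ ℓ₂) where
  open ExponentialField ℂ hiding (zero)
  private module ℂ = CommutativeRing commutativeRing
  open Φ ℂ
  open RootsOfUnity ℂ
  open LaurentProperties commutativeRing
  open MonomialSeparation commutativeRing
  open Specialisation ℂ
  private
    0ᵥ : ∀ {n} → Vec ℤ n
    0ᵥ = Vec.replicate _ 0ℤ

  signedUnit : Fin 2 → ℤ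
  signedUnit zero       = 1ℤ
  signedUnit (suc zero) = -1ℤ

  signedUnit≢0 : ∀ s → signedUnit s ≢ 0ℤ
  signedUnit≢0 zero       ()
  signedUnit≢0 (suc zero) ()

  signedUnit-injective : ∀ s s′ → s ≢ s′ → signedUnit s ≢ signedUnit s′
  signedUnit-injective zero       zero       s≢s′ _ = s≢s′ ≡.refl
  signedUnit-injective zero       (suc zero) s≢s′ ()
  signedUnit-injective (suc zero) zero       s≢s′ ()
  signedUnit-injective (suc zero) (suc zero) s≢s′ _ = s≢s′ ≡.refl

  axis : ∀ {r} → Fin r × Fin 2 → Vec ℤ r
  axis (k , s) = 0ᵥ [ k ]≔ signedUnit s

  -- `point` as a function of the label, with `var` and `var⁻¹` brought to one shape. Separation can
  -- then be decided by cases on labels.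
  coordinate : ∀ t .{{_ : NonZero t}} r → Label t r → Laurent r
  coordinate t r (inj₁ k) = const (ζ t ^ toℕ k)
  coordinate t r (inj₂ p) = List.[ 1# , axis p ]

  point≡coordinate : ∀ t .{{_ : NonZero t}} r i → point t r i ≡ coordinate t r (label t r i)
  point≡coordinate t r i with splitAt t i
  ... | inj₁ k = ≡.refl
  ... | inj₂ p with quotRem {r} 2 p
  ...   | zero     , k = ≡.refl
  ...   | suc zero , k = ≡.refl

  lookup-axis : ∀ {r} (k : Fin r) s → Vec.lookup (axis (k , s)) k ≡ signedUnit s
  lookup-axis k s = Vec.lookup∘update k 0ᵥ (signedUnit s)

  lookup-axis-other : ∀ {r} {k l : Fin r} s → k ≢ l → Vec.lookup (axis (l , s)) k ≡ 0ℤ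
  lookup-axis-other {k = k} s k≢l = ≡.trans (Vec.lookup∘update′ k≢l 0ᵥ (signedUnit s)) (Vec.lookup-replicate k 0ℤ)

  module _ (t : ℕ) .{{_ : NonZero t}} (r : ℕ) where
    open DeterminantProperties (laurentCommutativeRing r) using (Separated; PairwiseSeparated)

    private
      along : ∀ {a b a⁻¹} {d e : Vec ℤ r} k {i j} → a⁻¹ * a ≈ 1# →
              Vec.lookup d k ≡ i → Vec.lookup e k ≡ j → i ≢ j → Separated List.[ a , d ] List.[ b , e ]
      along {a⁻¹ = a⁻¹} {d} {e} k inverse dₖ≡i eₖ≡j i≢j = separated-exponents {d = d} {e} {k}
        (λ dₖ≡eₖ → i≢j (≡.trans (≡.sym dₖ≡i) (≡.trans dₖ≡eₖ eₖ≡j))) {a⁻¹ = a⁻¹} inverse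

    -- Except for two roots of unity, coordinate `k` of the exponents tells the points apart: it is
    -- 1 or -1 at variable `k`, and 0 at constants and at other variables.
    coordinate-separated : ∀ x y → x ≢ y → Separated (coordinate t r x) (coordinate t r y)
    coordinate-separated (inj₁ i) (inj₁ j) x≢y =
      separated-coefficients 0ᵥ (≉⇒separated (ζ^-injective t (x≢y ∘ ≡.cong inj₁)))
    coordinate-separated (inj₁ i) (inj₂ (k , s)) x≢y =
      along k (ζ^-isUnit t (toℕ i)) (Vec.lookup-replicate k 0ℤ) (lookup-axis k s) (signedUnit≢0 s ∘ ≡.sym)
    coordinate-separated (inj₂ (k , s)) (inj₁ j) x≢y =
      along k (*-identityˡ 1#) (lookup-axis k s) (Vec.lookup-replicate k 0ℤ) (signedUnit≢0 s)
    coordinate-separated (inj₂ (k , s)) (inj₂ (l , s′)) x≢y with k Fin.≟ l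
    ... | yes ≡.refl = along k (*-identityˡ 1#) (lookup-axis k s) (lookup-axis k s′)
                         (signedUnit-injective s s′ (x≢y ∘ ≡.cong (λ s → inj₂ (k , s))))
    ... | no k≢l     = along k (*-identityˡ 1#) (lookup-axis k s) (lookup-axis-other s′ k≢l) (signedUnit≢0 s)

    point-separated : PairwiseSeparated (point t r)
    point-separated {i} {j} i≢j = ≡.subst₂ Separated
      (≡.sym (point≡coordinate t r i)) (≡.sym (point≡coordinate t r j))
      (coordinate-separated _ _ (i≢j ∘ label-injective t r))

    tabulate-point : tabulate (point t r) ≡ tabulate (λ k → const (ζ t ^ toℕ k)) ++ pairs r var var⁻¹
    tabulate-point = ≡.trans (List.tabulate-cong (point≡coordinate t r)) (tabulate-label t r (coordinate t r))

  const-cong : ∀ {r a b} → a ≈ b → const {r} a ≈ᴸ const b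
  const-cong a≈b = singleton-cong {d = 0ᵥ} a≈b ≡.refl

  -- With u = w + 1 the exponents 0, m + 1, …, m + w are those of the u-th roots of unity.
  module _ (t m w r : ℕ) .{{_ : NonZero t}} (t≡ : t ≡ suc (m ℕ.+ (w ℕ.+ m)))
           (middle : ∀ (k : Fin w) → ζ (suc w) ^ suc (toℕ k) ≈ ζ t ^ suc (m ℕ.+ toℕ k)) where
    open CommutativeRing (laurentCommutativeRing r) using () renaming (setoid to setoidᴸ)
    open Permutation setoidᴸ using (_↭_; ↭-reflexive-≋; module PermutationReasoning)
    open TabulatePermutation setoidᴸ using (unfold-pairs)
    open import Algebra.Properties.Semiring.Exp ℂ.semiring using (^-homo-*)

    private
      u : ℕ
      u = suc w
      σ : Laurent (m ℕ.+ r) → Laurent r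
      σ = specialiseAtRoots t m
      y : Fin m → Carrier
      y k = ζ t ^ suc (toℕ k)
      y-unit : ∀ k → IsUnit (y k)
      y-unit k = ^-isUnit (ζ-isUnit t) (suc (toℕ k))
      E : ℕ → Laurent r
      E n = const (ζ t ^ n)

    -- Both sides become 1 when multiplied by ξᵏ⁺¹, because ξᵗ = 1.
    inverse-power : ∀ k n → n ℕ.+ suc (toℕ k) ≡ t → proj₁ (y-unit k) ≈ ζ t ^ n
    inverse-power k n n+k≡t = *-cancelˡ-unit (ζ^-isUnit t (suc (toℕ k))) $ begin
      y k * proj₁ (y-unit k)       ≈⟨ proj₂ (proj₂ (y-unit k)) ⟩
      1#                           ≈⟨ ζ^t≈1 t ⟨
      ζ t ^ t                      ≡⟨ ≡.cong (ζ t ^_) n+k≡t ⟨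
      ζ t ^ (n ℕ.+ suc (toℕ k))    ≈⟨ ^-homo-* (ζ t) n (suc (toℕ k)) ⟩
      ζ t ^ n * y k                ≈⟨ *-comm _ _ ⟩
      y k * ζ t ^ n                ∎
      where open import Relation.Binary.Reasoning.Setoid ℂ.setoid

    -- Indices start at 0, so `k` stands for the variable sent to ξᵏ⁺¹ and `opposite k` is m - 1 -
    -- k. The first summand is therefore t - (k + 1), the exponent of the inverse.
    reflected-exponent : ∀ k → suc (m ℕ.+ (w ℕ.+ toℕ (opposite k))) ℕ.+ suc (toℕ k) ≡ t
    reflected-exponent k = begin
      suc (m ℕ.+ (w ℕ.+ k′)) ℕ.+ suc (toℕ k)  ≡⟨ ≡.cong suc (ℕ.+-assoc m (w ℕ.+ k′) (suc (toℕ k))) ⟩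
      suc (m ℕ.+ (w ℕ.+ k′ ℕ.+ suc (toℕ k)))  ≡⟨ ≡.cong (λ n → suc (m ℕ.+ n)) (ℕ.+-assoc w k′ (suc (toℕ k))) ⟩
      suc (m ℕ.+ (w ℕ.+ (k′ ℕ.+ suc (toℕ k)))) ≡⟨ ≡.cong (λ n → suc (m ℕ.+ (w ℕ.+ n))) k′+k≡m ⟩
      suc (m ℕ.+ (w ℕ.+ m))                   ≡⟨ t≡ ⟨
      t                                       ∎
      where
      open ≡-Reasoning
      k′ : ℕ
      k′ = toℕ (opposite k)
      k′+k≡m : k′ ℕ.+ suc (toℕ k) ≡ m
      k′+k≡m = ≡.trans (≡.cong (ℕ._+ suc (toℕ k)) (Fin.opposite-prop k)) (ℕ.m∸n+n≡m (Fin.toℕ<n k))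

    specialise-root : ∀ k → σ (const (ζ u ^ toℕ {u} k)) ≈ᴸ const (ζ u ^ toℕ k)
    specialise-root k = specialise-const {m} {r} y y-unit (ζ u ^ toℕ k)

    specialise-var : ∀ k → σ (var (k ↑ˡ r)) ≈ᴸ E (suc (toℕ k))
    specialise-var k e = trans (specialise-substituted {m} {r} y y-unit k 1ℤ e) (const-cong (*-identityʳ (y k)) e)

    specialise-var⁻¹ : ∀ k → σ (var⁻¹ (k ↑ˡ r)) ≈ᴸ E (suc (m ℕ.+ (w ℕ.+ toℕ (opposite k))))
    specialise-var⁻¹ k e = trans (specialise-substituted {m} {r} y y-unit k -1ℤ e)
      (const-cong (trans (*-identityʳ _) (inverse-power k (suc (m ℕ.+ (w ℕ.+ toℕ (opposite k)))) (reflected-exponent k))) e)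

    points-↭ : tabulate (σ ∘ point u (m ℕ.+ r)) ↭ tabulate (point t r)
    points-↭ = begin
      tabulate (σ ∘ point u (m ℕ.+ r))
        ≡⟨ List.tabulate-cong (≡.cong σ ∘ point≡coordinate u (m ℕ.+ r)) ⟩
      tabulate (σ ∘ coordinate u (m ℕ.+ r) ∘ label u (m ℕ.+ r))
        ≡⟨ tabulate-label u (m ℕ.+ r) (σ ∘ coordinate u (m ℕ.+ r)) ⟩
      tabulate (λ k → σ (const (ζ u ^ toℕ {u} k))) ++ pairs (m ℕ.+ r) (σ ∘ var) (σ ∘ var⁻¹)
        ≡⟨ ≡.cong (tabulate (λ k → σ (const (ζ u ^ toℕ {u} k))) ++_) (pairs-+ m r (σ ∘ var) (σ ∘ var⁻¹)) ⟩
      tabulate (λ k → σ (const (ζ u ^ toℕ {u} k))) ++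
        (pairs m (σ ∘ var ∘ (_↑ˡ r)) (σ ∘ var⁻¹ ∘ (_↑ˡ r)) ++ pairs r (σ ∘ var ∘ (m ↑ʳ_)) (σ ∘ var⁻¹ ∘ (m ↑ʳ_)))
        -- Entry by entry up to equality of Laurent polynomials: the root 1 has exponent 0, the
        -- other `w` roots of order `u` have the middle exponents, and the free variables are
        -- unchanged.
        ↭⟨ ↭-reflexive-≋ (Pointwise.++⁺ (specialise-root zero ∷ Pointwise.tabulate⁺ middle-roots)
             (Pointwise.++⁺ (pairs-pointwise m specialise-var specialise-var⁻¹)
               (pairs-pointwise r (λ k → specialise-free {m} {r} y y-unit k 1ℤ)
                                  (λ k → specialise-free {m} {r} y y-unit k -1ℤ)))) ⟩
      (E 0 ∷ tabulate {n = w} (λ k → E (suc (m ℕ.+ toℕ k)))) ++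
        (pairs m (λ k → E (suc (toℕ k))) (λ k → E (suc (m ℕ.+ (w ℕ.+ toℕ (opposite k))))) ++ pairs r var var⁻¹)
        ↭⟨ unfold-pairs m w E t≡ (pairs r var var⁻¹) ⟩
      tabulate {n = t} (E ∘ toℕ) ++ pairs r var var⁻¹
        ≡⟨ tabulate-point t r ⟨
      tabulate (point t r) ∎
      where
      open PermutationReasoning
      middle-roots : ∀ k → σ (const (ζ u ^ toℕ {u} (suc k))) ≈ᴸ E (suc (m ℕ.+ toℕ k))
      middle-roots k e = trans (specialise-root (suc k) e) (const-cong (middle k) e)

    Φ-specialises : ∀ (N≡ : size u (m ℕ.+ r) ≡ size t r) β f g →
                    IsΦ t r β f → IsΦ u (m ℕ.+ r) (β ∘ cast N≡) g → f ≈ᴸ σ g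
    Φ-specialises N≡ = alternant-quotient-homo N≡ (point u (m ℕ.+ r)) (point t r) points-↭ (point-separated t r)
      where
      open DeterminantHomomorphism (laurentCommutativeRing (m ℕ.+ r)) (laurentCommutativeRing r)
        (specialise-isRingHomomorphism {m} {r} y y-unit) using (alternant-quotient-homo)

-- The two parities of `t`.

open import Data.Nat.Base using (_+_; _*_)

size-≡ : ∀ {t} m w r → t ≡ suc (m + (w + m)) → suc w + (m + r) * 2 ≡ t + r * 2
size-≡ m w r ≡.refl =
  solve 3 (λ m w r → con 1 :+ w :+ (m :+ r) :* con 2 := con 1 :+ (m :+ (w :+ m)) :+ r :* con 2) ≡.refl m w r
  where open ℕSolver

proposition2p1 : ∀ {c ℓ₁ ℓ₂} (ℂ : ExponentialField c ℓ₁ ℓ₂) → let open Φ ℂ in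
    (t r : ℕ) .{{_ : NonZero t}} .{{_ : NonZero r}} →
    (β : Fin (size t r) → ℕ) → StrictlyDecreasing β → EndsInZero β →
    (∀ m → t ≡ 2 * m + 2 →
    Σ[ N≡ ∈ size 2 (m + r) ≡ size t r ]
    (∀ f g → IsΦ t r β f → IsΦ 2 (m + r) (β ∘ cast N≡) g →
    f ≈ᴸ specialiseAtRoots t m g))
    × (∀ m′ → t ≡ 2 * m′ + 1 →
    Σ[ N≡ ∈ size 1 (m′ + r) ≡ size t r ]
    (∀ f g → IsΦ t r β f → IsΦ 1 (m′ + r) (β ∘ cast N≡) g →
    f ≈ᴸ specialiseAtRoots t m′ g))
proposition2p1 ℂ t r β _ _ = even , odd
  where
  open Φ ℂ
  open ExponentialField ℂ using (ζ; _≈_; _^_; *-identityʳ; sym; trans)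
  open RootsOfUnity ℂ using (ζ-tower)
  open Points ℂ using (Φ-specialises)

  even : ∀ m → t ≡ 2 * m + 2 →
         Σ[ N≡ ∈ size 2 (m + r) ≡ size t r ]
         (∀ f g → IsΦ t r β f → IsΦ 2 (m + r) (β ∘ cast N≡) g → f ≈ᴸ specialiseAtRoots t m g)
  -- Here `w = 1`: the only middle exponent is m + 1 = t / 2, and it belongs to the point -1.
  even m t≡ = size-≡ m 1 r t≡′ , Φ-specialises t m 1 r t≡′ middle (size-≡ m 1 r t≡′) β
    where
    t≡′ : t ≡ suc (m + (1 + m))
    t≡′ = ≡.trans t≡ (solve 1 (λ m → con 2 :* m :+ con 2 := con 1 :+ (m :+ (con 1 :+ m))) ≡.refl m)
      where open ℕSolver
    middle : ∀ (k : Fin 1) → ζ 2 ^ suc (toℕ k) ≈ ζ t ^ suc (m + toℕ k)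
    -- The exponent unfolds to `suc (m + 0)`, so `ζ-tower` is used in this form.
    middle zero = trans (*-identityʳ (ζ 2)) (sym (ζ-tower (suc (m + 0)) 2 t≡″))
      where
      t≡″ : t ≡ suc (m + 0) * 2
      t≡″ = ≡.trans t≡ (solve 1 (λ m → con 2 :* m :+ con 2 := (con 1 :+ (m :+ con 0)) :* con 2) ≡.refl m)
        where open ℕSolver

  odd : ∀ m → t ≡ 2 * m + 1 →
        Σ[ N≡ ∈ size 1 (m + r) ≡ size t r ]
        (∀ f g → IsΦ t r β f → IsΦ 1 (m + r) (β ∘ cast N≡) g → f ≈ᴸ specialiseAtRoots t m g)
  -- Here `w = 0`: every exponent but 0 has a partner, so there is no middle root to identify.
  odd m t≡ = size-≡ m 0 r t≡′ , Φ-specialises t m 0 r t≡′ (λ ()) (size-≡ m 0 r t≡′) β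
    where
    t≡′ : t ≡ suc (m + m)
    t≡′ = ≡.trans t≡ (solve 1 (λ m → con 2 :* m :+ con 1 := con 1 :+ (m :+ m)) ≡.refl m)
      where open ℕSolver
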